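{- Let $n\ge 1$ and $k\ge 0$ be integers such that $\mathscr{G}_n^k$ is nonempty. Among all connected graphs with $n$ vertices and exactly $k$ cut edges, the last graph in the $S$-order is uniquely $K_n^k$; that is, $K_n^k\in\mathscr{G}_n^k$ and $G\prec_s K_n^k$ for every $G\in\mathscr{G}_n^k$ not isomorphic to $K_n^k$.
   Context: All graphs are finite, simple, undirected and connected. A cut edge of a connected graph is an edge whose deletion breaks the graph into two components. $\mathscr{G}_n^k$ is the set of all connected $n$-vertex graphs with exactly $k$ cut edges (graphs are considered up to isomorphism). For an $n$-vertex graph $G$ with adjacency eigenvalues $\lambda_1(G)\ge\dots\ge\lambda_n(G)$, the $i$th spectral moment is $S_i(G)=\sum_{j=1}^n\lambda_j(G)^i$ for $i=0,1,\dots,n-1$. For two $n$-vertex graphs $G_1,G_2$, write $G_1\prec_s G_2$ ($G_1$ comes before $G_2$ in the $S$-order) if for some $j\in\{1,\dots,n-1\}$ we have $S_i(G_1)=S_i(G_2)$ for $i=0,1,\dots,j-1$ and $S_j(G_1)<S_j(G_2)$. $K_m$ is the complete graph on $m$ vertices. $K_n^k$ is the $n$-vertex graph obtained by attaching $k$ pendant vertices to one vertex of $K_{n-k}$ (so $K_n^0=K_n$ and $K_n^{n-1}$ is the star $K_{1,n-1}$).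
   Formalization: The comparison is claimed for all (n,k) except (4,3): there the path P_4 and the star K_4^3 have equal moments S_0,…,S_3 = 4,0,6,0, so the claim as stated fails; K_n^k ∈ G_n^k is still claimed for (4,3). -}

module Defs where

open import Level using (Level; 0ℓ; _⊔_) renaming (suc to lsuc)
open import Algebra.Apartness.Bundles using (HeytingField; HeytingCommutativeRing)
open import Algebra.Bundles using (CommutativeRing)
import Algebra.Definitions.RawMonoid as RawMonoidOps
open import Data.Fin as Fin using (Fin; toℕ)
import Data.Fin.Properties as Finₚ
open import Data.Fin.Permutation using (Permutation′; _⟨$⟩ʳ_)
open import Data.List using (List; length)
open import Data.List.Membership.Propositional using (_∈_)
open import Data.List.Relation.Unary.Unique.Propositional using (Unique)
open import Data.Nat as ℕ using (ℕ; _∸_)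
import Data.Nat.Properties as ℕₚ
open import Data.Product using (Σ; ∃; _×_; _,_; ∃-syntax; swap)
open import Data.Sum as Sum using (_⊎_)
open import Data.Vec.Functional using (Vector)
open import Function using (_∘_; _⇔_)
open import Function.Definitions using (Surjective)
open import Relation.Binary using (Rel; Decidable; Symmetric; IsStrictPartialOrder)
open import Relation.Binary.Construct.Closure.ReflexiveTransitive using (Star)
open import Relation.Binary.PropositionalEquality using (_≡_; _≢_; refl; sym)
open import Relation.Nullary using (¬_; yes; no)
open import Relation.Nullary.Decidable using (_×-dec_; _⊎-dec_; ¬?)

-- Real numbers

-- The standard library has no real numbers, so they are specified
-- axiomatically: an Archimedean, Cauchy complete ordered field.  Classically
-- ℝ is the only such field up to isomorphism.  The axioms are phrased with
-- the apartness _#_ of a Heyting field, because neither decidable equality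
-- nor trichotomy of _<_ is available constructively.
record RealNumbers (c ℓ₁ ℓ₂ ℓ₃ : Level) : Set (lsuc (c ⊔ ℓ₁ ⊔ ℓ₂ ⊔ ℓ₃)) where
  infix 4 _<_
  field
    heytingField : HeytingField c ℓ₁ ℓ₂

  open HeytingField heytingField public
    using ( Carrier; _≈_; _#_; _+_; _*_; -_; _-_; 0#; 1#
          ; isHeytingField; heytingCommutativeRing)
  open HeytingCommutativeRing heytingCommutativeRing public
    using (commutativeRing)
  open CommutativeRing commutativeRing public
    using (semiring; +-rawMonoid)
  open RawMonoidOps +-rawMonoid public
    using () renaming (_×_ to _·_)

  field
    _<_                  : Rel Carrier ℓ₃
    isStrictPartialOrder : IsStrictPartialOrder _≈_ _<_
    #⇔<∨>                : ∀ x y → x # y ⇔ (x < y ⊎ y < x)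
    +-monoˡ-<            : ∀ z {x y} → x < y → x + z < y + z
    *-positive           : ∀ {x y} → 0# < x → 0# < y → 0# < x * y
    archimedean          : ∀ x → ∃[ n ] (x < n · 1#)

  -- As m and n range independently, this bounds ∣ x m - x n ∣.
  IsCauchy : (ℕ → Carrier) → Set (c ⊔ ℓ₃)
  IsCauchy x = ∀ ε → 0# < ε →
    ∃[ N ] (∀ m n → N ℕ.≤ m → N ℕ.≤ n → x m - x n < ε)

  _ConvergesTo_ : (ℕ → Carrier) → Carrier → Set (c ⊔ ℓ₃)
  x ConvergesTo l = ∀ ε → 0# < ε →
    ∃[ N ] (∀ n → N ℕ.≤ n → (x n - l < ε) × (l - x n < ε))

  field
    complete : ∀ x → IsCauchy x → ∃[ l ] (x ConvergesTo l)

-- Graphs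

record Graph (n : ℕ) : Set₁ where
  field
    Adj    : Rel (Fin n) 0ℓ
    adj?   : Decidable Adj
    symm   : Symmetric Adj
    irrefl : ∀ {x} → ¬ Adj x x

open Graph public

infix 4 _≅_

_≅_ : ∀ {n} → Graph n → Graph n → Set
_≅_ {n} G H = Σ (Permutation′ n) λ π →
  ∀ x y → Adj G x y ⇔ Adj H (π ⟨$⟩ʳ x) (π ⟨$⟩ʳ y)

Reachable : ∀ {n} → Graph n → Rel (Fin n) 0ℓ
Reachable G = Star (Adj G)

Connected : ∀ {n} → Graph n → Set
Connected G = ∀ x y → Reachable G x y

HasComponents : ∀ {n} → Graph n → ℕ → Set
HasComponents {n} G m = Σ (Fin n → Fin m) λ comp →
  Surjective _≡_ _≡_ comp ×
  (∀ x y → (comp x ≡ comp y) ⇔ Reachable G x y)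

deleteEdge : ∀ {n} → Graph n → Fin n → Fin n → Graph n
deleteEdge G u v = record
  { Adj    = λ x y → Adj G x y × ¬ IsUV x y
  ; adj?   = λ x y → adj? G x y ×-dec ¬? (isUV? x y)
  ; symm   = λ (a , ¬uv) → symm G a , ¬uv ∘ Sum.swap ∘ Sum.map swap swap
  ; irrefl = λ (a , _) → irrefl G a
  }
  where
  IsUV : Rel (Fin _) 0ℓ
  IsUV x y = (x ≡ u × y ≡ v) ⊎ (x ≡ v × y ≡ u)

  isUV? : Decidable IsUV
  isUV? x y = (x Finₚ.≟ u ×-dec y Finₚ.≟ v) ⊎-dec (x Finₚ.≟ v ×-dec y Finₚ.≟ u)

CutEdge : ∀ {n} → Graph n → Rel (Fin n) 0ℓ
CutEdge G u v = Adj G u v × HasComponents (deleteEdge G u v) 2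

-- Each undirected edge {u , v} is listed once, as the pair with u < v.
HasCutEdges : ∀ {n} → Graph n → ℕ → Set
HasCutEdges {n} G k = Σ (List (Fin n × Fin n)) λ es →
  Unique es × length es ≡ k ×
  (∀ u v → ((u , v) ∈ es) ⇔ (u Fin.< v × CutEdge G u v))

𝒢 : (n k : ℕ) → Graph n → Set
𝒢 n k G = Connected G × HasCutEdges G k

-- The vertices numbered below n ∸ k form the complete graph; the others are
-- the k pendant vertices, all attached to vertex 0.  Meaningful for k < n.
K : (n k : ℕ) → Graph n
K n k = record
  { Adj    = λ x y → x ≢ y × Joined x y
  ; adj?   = λ x y → ¬? (x Finₚ.≟ y) ×-dec joined? x y
  ; symm   = λ (x≢y , j) → x≢y ∘ sym , Sum.map swap Sum.swap j
  ; irrefl = λ (x≢x , _) → x≢x refl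
  }
  where
  InClique : Fin n → Set
  InClique x = toℕ x ℕ.< n ∸ k

  PendantAt : Rel (Fin n) 0ℓ
  PendantAt x y = toℕ x ≡ 0 × n ∸ k ℕ.≤ toℕ y

  Joined : Rel (Fin n) 0ℓ
  Joined x y = (InClique x × InClique y) ⊎ (PendantAt x y ⊎ PendantAt y x)

  pendantAt? : Decidable PendantAt
  pendantAt? x y = toℕ x ℕₚ.≟ 0 ×-dec n ∸ k ℕₚ.≤? toℕ y

  joined? : Decidable Joined
  joined? x y = (toℕ x ℕₚ.<? n ∸ k ×-dec toℕ y ℕₚ.<? n ∸ k)
                ⊎-dec (pendantAt? x y ⊎-dec pendantAt? y x)

-- Spectral moments

module Spectral {c ℓ₁ ℓ₂ ℓ₃ : Level} (ℝ : RealNumbers c ℓ₁ ℓ₂ ℓ₃) where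
  open RealNumbers ℝ
  open import Algebra.Properties.Semiring.Sum semiring using (sum-syntax)
  open import Algebra.Properties.Semiring.Exp semiring using (_^_)

  adjacencyMatrix : ∀ {n} → Graph n → Fin n → Fin n → Carrier
  adjacencyMatrix G x y with adj? G x y
  ... | yes _ = 1#
  ... | no  _ = 0#

  linearCombination : ∀ {m n} → Vector Carrier m → Vector (Vector Carrier n) m →
                      Vector Carrier n
  linearCombination {m} a v x = ∑[ j < m ] (a j * v j x)

  LinearlyIndependent : ∀ {m n} → Vector (Vector Carrier n) m → Set (c ⊔ ℓ₁)
  LinearlyIndependent v =
    ∀ a → (∀ x → linearCombination a v x ≈ 0#) → ∀ j → a j ≈ 0#

  Spanning : ∀ {m n} → Vector (Vector Carrier n) m → Set (c ⊔ ℓ₁)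
  Spanning {n = n} v = ∀ (w : Vector Carrier n) → ∃[ a ] (∀ x → linearCombination a v x ≈ w x)

  -- The eigenvalues λ₁ ≥ … ≥ λₙ of the adjacency matrix, listed with
  -- multiplicity, i.e. together with a basis of eigenvectors.  They exist by
  -- the spectral theorem for real symmetric matrices.
  record Spectrum {n : ℕ} (G : Graph n) : Set (c ⊔ ℓ₁ ⊔ ℓ₃) where
    field
      eigenvalue  : Vector Carrier n
      eigenvector : Vector (Vector Carrier n) n
      eigen       : ∀ j x → ∑[ y < n ] (adjacencyMatrix G x y * eigenvector j y)
                              ≈ eigenvalue j * eigenvector j x
      independent : LinearlyIndependent eigenvector
      spanning    : Spanning eigenvector
      decreasing  : ∀ i j → i Fin.≤ j → ¬ (eigenvalue i < eigenvalue j)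

  S : ∀ {n} {G : Graph n} → ℕ → Spectrum G → Carrier
  S {n} i σ = ∑[ j < n ] (Spectrum.eigenvalue σ j ^ i)

  infix 4 _≺ₛ_

  -- The eigenvalues in a Spectrum are unique, so the quantification only names
  -- those of G₁ and of G₂.
  _≺ₛ_ : ∀ {n} → Graph n → Graph n → Set (c ⊔ ℓ₁ ⊔ ℓ₃)
  _≺ₛ_ {n} G₁ G₂ = (σ₁ : Spectrum G₁) (σ₂ : Spectrum G₂) →
    ∃[ j ] (1 ℕ.≤ j × j ℕ.≤ n ∸ 1 ×
            (∀ i → i ℕ.< j → S i σ₁ ≈ S i σ₂) ×
            S j σ₁ < S j σ₂)

{-# OPTIONS --safe #-}
module Submission where

-- The i-th spectral moment is the number of closed walks of length i, so the
-- moments up to S₄ are read off from the edges and the numbers of common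
-- neighbours.
--
-- Contracting the k bridges of G leaves r = n - k classes of vertices.  Two
-- classes are joined by at most one other edge, since a second one would put
-- a bridge on a cycle.  So G has at most k + r(r-1)/2 edges, and S₂ decides
-- unless every two classes are joined.  In that case the edges that are not
-- bridges form a complete graph on one vertex of each class: they have r - 2
-- common neighbours each, a bridge has none, and two distinct nonadjacent
-- vertices have at most one.  Hence S₃ is determined and S₄ is largest when
-- every two distinct nonadjacent vertices have a common neighbour, which
-- forces a vertex adjacent to all others and thereby K n k.

open import Defs
open import Data.Nat using (ℕ; _≤_)
open import Data.Product using (∃-syntax; _×_)
open import Relation.Binary.PropositionalEquality using (_≡_)
open import Relation.Nullary using (¬_)

open import Algebra.Apartness.Structures using (IsHeytingField)
open import Algebra.Bundles using (CommutativeRing)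
import Algebra.Properties.Semiring.Sum as SemiringSum
open import Data.Bool using (if_then_else_)
open import Data.Empty using (⊥)
open import Data.Fin as Fin using (Fin; zero; suc; toℕ; punchIn; punchOut)
import Data.Fin.Permutation.Components as PC
open import Data.Fin.Permutation as Perm using (Permutation′; _⟨$⟩ʳ_; _⟨$⟩ˡ_; _∘ₚ_)
import Data.Fin.Properties as Finₚ
open import Data.List using (List; []; _∷_; length; tabulate)
import Data.List.Membership.DecPropositional as DecMembership
open import Data.List.Membership.Propositional using (_∈_)
open import Data.List.Membership.Propositional.Properties using (∈-tabulate⁺; ∈-tabulate⁻)
open import Data.List.Properties using (length-tabulate)
open import Data.List.Relation.Unary.All using ([]; _∷_)
open import Data.List.Relation.Unary.AllPairs using ([]; _∷_)
open import Data.List.Relation.Unary.Any using (here; there)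
open import Data.List.Relation.Unary.Unique.Propositional using (Unique)
open import Data.List.Relation.Unary.Unique.Propositional.Properties
  using (Unique[x∷xs]⇒x∉xs; tabulate⁺)
open import Data.Nat as ℕ using (zero; suc; _+_; _*_; _∸_; _<_; z≤n; s≤s)
import Data.Nat.Properties as ℕₚ
open import Data.Product using (Σ; _,_; proj₁; proj₂)
open import Data.Product.Properties using (≡-dec)
open import Data.Sum as Sum using (_⊎_; inj₁; inj₂)
open import Data.Unit using (⊤; tt)
open import Function using (_∘_; Equivalence; id; _⇔_; mk⇔)
open import Function.Construct.Composition using (_⇔-∘_)
open import Level using (Level; 0ℓ)
open import Relation.Binary using (IsStrictPartialOrder; Rel; tri<; tri≈; tri>)
open import Relation.Binary.Construct.Closure.ReflexiveTransitive as Star using (Star; ε; _◅_; _◅◅_)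
open import Relation.Binary.PropositionalEquality
  using (_≢_; refl; sym; trans; cong; cong₂; subst; module ≡-Reasoning)
import Relation.Binary.Reasoning.Setoid as SetoidReasoning
open import Relation.Nullary using (Dec; yes; no; does; contradiction)
open import Relation.Nullary.Decidable using (_×-dec_; _⊎-dec_; ¬?; decidable-stable)

open SemiringSum ℕₚ.+-*-semiring
  using (sum; sum-syntax; sum-cong-≗; ∑-distrib-+; ∑-comm; *-distribˡ-sum; *-distribʳ-sum; sum-replicate-zero)

-- The order only looks at moments with index at most `n ∸ 1`, so a comparison of S₄ needs five
-- vertices. With n = 4 and k = 3 the path and the star agree in S₀ to S₃, and S₄ is out of range:
-- neither precedes the other, which is why that pair is excluded. In the remaining cases that need
-- S₄, two vertices at distance at least three force five vertices: one class means a tree, two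
-- classes never occur, and three classes give three vertices on cycles in addition to two off them.
--
-- No moment of `K n k` is computed in closed form. It is put through the same counting as `G`, as
-- an instance in which every two classes are joined and no two vertices are at distance three or
-- more. The counting takes place in ℕ; the reals enter only through the trace formula, which has to
-- manage with a basis of eigenvectors that need not be orthonormal.

private variable
  n r : ℕ
  P Q R : Set

-- Spectral moments count closed walks

-- Reading only `does` lets the indicator of `suc x ≟ suc y` reduce to that of `x ≟ y`, on which the
-- inductions for delta sums rely.
⟦_⟧ : ∀ {p} {P : Set p} → Dec P → ℕ
⟦ P? ⟧ = if does P? then 1 else 0

adjacency : ∀ {n} → Graph n → Fin n → Fin n → ℕ
adjacency G x y = ⟦ adj? G x y ⟧

walks : ∀ {n} → Graph n → ℕ → Fin n → Fin n → ℕ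
walks         G zero    x y = ⟦ x Finₚ.≟ y ⟧
walks {n = n} G (suc i) x y = ∑[ z < n ] (adjacency G x z * walks G i z y)

closedWalks : ∀ {n} → Graph n → ℕ → ℕ
closedWalks {n} G i = ∑[ x < n ] walks G i x x

module Moments {c ℓ₁ ℓ₂ ℓ₃ : Level} (ℝ : RealNumbers c ℓ₁ ℓ₂ ℓ₃) where
  open RealNumbers ℝ renaming (_+_ to _+ᴿ_; _*_ to _*ᴿ_; _<_ to _<ᴿ_)
  open Spectral ℝ
  private module R = CommutativeRing commutativeRing
  open import Algebra.Properties.Ring R.ring
    using (-1*x≈-x; -‿distribˡ-*; -‿involutive; x∙y⁻¹≈ε⇒x≈y; -0#≈0#)
  open import Algebra.Properties.Semiring.Exp semiring using (_^_)
  open import Algebra.Properties.Semiring.Mult semiring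
    using (×-homo-+; ×-homo-1; ×1-homo-*; ×-congˡ)
  module Σᴿ = SemiringSum semiring
  open SetoidReasoning R.setoid

  ι : ℕ → Carrier
  ι m = m · 1#

  private
    <-resp-≈ : ∀ {x x′ y y′} → x ≈ x′ → y ≈ y′ → x <ᴿ y → x′ <ᴿ y′
    <-resp-≈ p q = proj₁ <-resp q ∘ proj₂ <-resp p
      where
      <-resp = IsStrictPartialOrder.<-resp-≈ isStrictPartialOrder

    1#0 : 1# # 0#
    1#0 = IsHeytingField.invertible⇒# isHeytingField
            (1# , R.trans (R.*-identityˡ _) 1-0≈1 , R.trans (R.*-identityʳ _) 1-0≈1)
      where
      1-0≈1 : 1# - 0# ≈ 1#
      1-0≈1 = R.trans (R.+-congˡ -0#≈0#) (R.+-identityʳ 1#)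

    -- Apartness of 1 and 0 leaves two orders. If 1 < 0 then 0 < -1, and the square of -1, which is
    -- 1, is positive after all.
    0<1 : 0# <ᴿ 1#
    0<1 with Equivalence.to (#⇔<∨> 1# 0#) 1#0
    ... | inj₂ 0<1 = 0<1
    ... | inj₁ 1<0 = <-resp-≈ R.refl [-1]²≈1 (*-positive 0<-1 0<-1)
      where
      0<-1 : 0# <ᴿ - 1#
      0<-1 = <-resp-≈ (R.-‿inverseʳ 1#) (R.+-identityˡ (- 1#)) (+-monoˡ-< (- 1#) 1<0)
      [-1]²≈1 : - 1# *ᴿ - 1# ≈ 1#
      [-1]²≈1 = R.trans (-1*x≈-x (- 1#)) (-‿involutive 1#)

  ι-mono-< : ∀ {m n} → m < n → ι m <ᴿ ι n
  ι-mono-< {m} {suc n} (s≤s m≤n) with ℕₚ.m≤n⇒m<n∨m≡n m≤n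
  ... | inj₁ m<n  = IsStrictPartialOrder.trans isStrictPartialOrder (ι-mono-< m<n) (n<1+n n)
    where
    n<1+n : ∀ n → ι n <ᴿ ι (suc n)
    n<1+n n = <-resp-≈ (R.+-identityˡ (ι n)) R.refl (+-monoˡ-< (ι n) 0<1)
  ... | inj₂ refl = <-resp-≈ (R.+-identityˡ (ι n)) R.refl (+-monoˡ-< (ι n) 0<1)

  ι-sum : ∀ {n} (f : Fin n → ℕ) → ι (sum f) ≈ Σᴿ.sum (ι ∘ f)
  ι-sum {zero}  f = R.refl
  ι-sum {suc n} f = R.trans (×-homo-+ 1# (f zero) _) (R.+-congˡ (ι-sum (f ∘ suc)))

  sum-ι-δ : ∀ {n} (x : Fin n) (f : Fin n → Carrier) →
            Σᴿ.sum (λ y → ι ⟦ x Finₚ.≟ y ⟧ *ᴿ f y) ≈ f x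
  sum-ι-δ {suc n} zero f = begin
    ι 1 *ᴿ f zero +ᴿ Σᴿ.sum (λ y → 0# *ᴿ f (suc y))
      ≈⟨ R.+-cong (R.trans (R.*-congʳ (×-homo-1 1#)) (R.*-identityˡ _))
                  (Σᴿ.sum-cong-≋ λ y → R.zeroˡ (f (suc y))) ⟩
    f zero +ᴿ Σᴿ.sum {n} (λ _ → 0#)  ≈⟨ R.+-congˡ (Σᴿ.sum-replicate-zero n) ⟩
    f zero +ᴿ 0#                     ≈⟨ R.+-identityʳ _ ⟩
    f zero                           ∎
  sum-ι-δ {suc n} (suc x) f = begin
    0# *ᴿ f zero +ᴿ Σᴿ.sum (λ y → ι ⟦ x Finₚ.≟ y ⟧ *ᴿ f (suc y))
      ≈⟨ R.+-cong (R.zeroˡ _) (sum-ι-δ x (f ∘ suc)) ⟩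
    0# +ᴿ f (suc x)  ≈⟨ R.+-identityˡ _ ⟩
    f (suc x)        ∎

  ι-adjacency : ∀ {n} (G : Graph n) x y → adjacencyMatrix G x y ≈ ι (adjacency G x y)
  ι-adjacency G x y with adj? G x y
  ... | yes _ = R.sym (×-homo-1 1#)
  ... | no  _ = R.refl

  module _ {n} {G : Graph n} (σ : Spectrum G) where
    open Spectrum σ renaming (eigenvalue to ev; eigenvector to v)

    -- `walks G i` is the i-th power of the adjacency matrix, so it keeps the eigenvectors and
    -- raises the eigenvalues to the i-th power.
    ι-walks-eigen : ∀ i j x →
      Σᴿ.sum (λ y → ι (walks G i x y) *ᴿ v j y) ≈ (ev j ^ i) *ᴿ v j x
    ι-walks-eigen zero    j x = R.trans (sum-ι-δ x (v j)) (R.sym (R.*-identityˡ _))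
    ι-walks-eigen (suc i) j x = begin
      Σᴿ.sum (λ y → ι (walks G (suc i) x y) *ᴿ v j y)
        ≈⟨ Σᴿ.sum-cong-≋ (λ y → R.*-congʳ (R.trans (ι-sum (λ z → adjacency G x z * walks G i z y))
             (Σᴿ.sum-cong-≋ λ z → ×1-homo-* (adjacency G x z) (walks G i z y)))) ⟩
      Σᴿ.sum (λ y → Σᴿ.sum (λ z → A z *ᴿ W z y) *ᴿ v j y)
        ≈⟨ Σᴿ.sum-cong-≋ (λ y → R.trans (Σᴿ.*-distribʳ-sum (v j y) λ z → A z *ᴿ W z y)
             (Σᴿ.sum-cong-≋ λ z → R.*-assoc (A z) (W z y) (v j y))) ⟩
      Σᴿ.sum (λ y → Σᴿ.sum (λ z → A z *ᴿ (W z y *ᴿ v j y)))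
        ≈⟨ Σᴿ.∑-comm (λ y z → A z *ᴿ (W z y *ᴿ v j y)) ⟩
      Σᴿ.sum (λ z → Σᴿ.sum (λ y → A z *ᴿ (W z y *ᴿ v j y)))
        ≈⟨ Σᴿ.sum-cong-≋ (λ z → R.sym (Σᴿ.*-distribˡ-sum (A z) λ y → W z y *ᴿ v j y)) ⟩
      Σᴿ.sum (λ z → A z *ᴿ Σᴿ.sum (λ y → W z y *ᴿ v j y))
        ≈⟨ Σᴿ.sum-cong-≋ (λ z → R.trans (R.*-congˡ (ι-walks-eigen i j z)) (swap-factors z)) ⟩
      Σᴿ.sum (λ z → (ev j ^ i) *ᴿ (adjacencyMatrix G x z *ᴿ v j z))
        ≈⟨ Σᴿ.*-distribˡ-sum (ev j ^ i) (λ z → adjacencyMatrix G x z *ᴿ v j z) ⟨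
      (ev j ^ i) *ᴿ Σᴿ.sum (λ z → adjacencyMatrix G x z *ᴿ v j z)
        ≈⟨ R.*-congˡ (eigen j x) ⟩
      (ev j ^ i) *ᴿ (ev j *ᴿ v j x)
        ≈⟨ R.*-assoc _ _ _ ⟨
      ((ev j ^ i) *ᴿ ev j) *ᴿ v j x
        ≈⟨ R.*-congʳ (R.*-comm _ _) ⟩
      (ev j *ᴿ (ev j ^ i)) *ᴿ v j x ∎
      where
      A : Fin n → Carrier
      A z = ι (adjacency G x z)
      W : Fin n → Fin n → Carrier
      W z y = ι (walks G i z y)
      swap-factors : ∀ z → A z *ᴿ ((ev j ^ i) *ᴿ v j z) ≈ (ev j ^ i) *ᴿ (adjacencyMatrix G x z *ᴿ v j z)
      swap-factors z = begin
        A z *ᴿ ((ev j ^ i) *ᴿ v j z)  ≈⟨ R.*-assoc _ _ _ ⟨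
        (A z *ᴿ (ev j ^ i)) *ᴿ v j z  ≈⟨ R.*-congʳ (R.*-comm _ _) ⟩
        ((ev j ^ i) *ᴿ A z) *ᴿ v j z  ≈⟨ R.*-assoc _ _ _ ⟩
        (ev j ^ i) *ᴿ (A z *ᴿ v j z)  ≈⟨ R.*-congˡ (R.*-congʳ (R.sym (ι-adjacency G x z))) ⟩
        (ev j ^ i) *ᴿ (adjacencyMatrix G x z *ᴿ v j z) ∎

    private
      -- Coordinates of the standard basis vectors in the eigenvector basis, that is, the inverse of
      -- the eigenvector matrix. It need not be the transpose, since `Spectrum` does not ask for
      -- orthonormality.
      dual : Fin n → Fin n → Carrier
      dual x = proj₁ (spanning λ y → ι ⟦ x Finₚ.≟ y ⟧)

      dual-span : ∀ x y → Σᴿ.sum (λ j → dual x j *ᴿ v j y) ≈ ι ⟦ x Finₚ.≟ y ⟧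
      dual-span x = proj₂ (spanning λ y → ι ⟦ x Finₚ.≟ y ⟧)

      pairing : Fin n → Fin n → Carrier
      pairing l j = Σᴿ.sum (λ x → v l x *ᴿ dual x j)

      -- With V the eigenvector matrix and D the matrix `dual`, D V = 1 gives (V D) V = V (D V) = V.
      pairing-span : ∀ l y → Σᴿ.sum (λ j → pairing l j *ᴿ v j y) ≈ v l y
      pairing-span l y = begin
        Σᴿ.sum (λ j → pairing l j *ᴿ v j y)
          ≈⟨ Σᴿ.sum-cong-≋ (λ j → R.trans (Σᴿ.*-distribʳ-sum (v j y) λ x → v l x *ᴿ dual x j)
               (Σᴿ.sum-cong-≋ λ x → R.*-assoc (v l x) (dual x j) (v j y))) ⟩
        Σᴿ.sum (λ j → Σᴿ.sum (λ x → v l x *ᴿ (dual x j *ᴿ v j y)))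
          ≈⟨ Σᴿ.∑-comm (λ j x → v l x *ᴿ (dual x j *ᴿ v j y)) ⟩
        Σᴿ.sum (λ x → Σᴿ.sum (λ j → v l x *ᴿ (dual x j *ᴿ v j y)))
          ≈⟨ Σᴿ.sum-cong-≋ (λ x → R.trans (R.sym (Σᴿ.*-distribˡ-sum (v l x) λ j → dual x j *ᴿ v j y))
               (R.trans (R.*-congˡ (dual-span x y))
               (R.trans (R.*-comm _ _) (R.*-congʳ (ι-δ-sym x y))))) ⟩
        Σᴿ.sum (λ x → ι ⟦ y Finₚ.≟ x ⟧ *ᴿ v l x)
          ≈⟨ sum-ι-δ y (v l) ⟩
        v l y ∎
        where
        ι-δ-sym : ∀ x y → ι ⟦ x Finₚ.≟ y ⟧ ≈ ι ⟦ y Finₚ.≟ x ⟧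
        ι-δ-sym x y with x Finₚ.≟ y | y Finₚ.≟ x
        ... | yes _    | yes _    = R.refl
        ... | no  _    | no  _    = R.refl
        ... | yes refl | no  y≢y  = contradiction refl y≢y
        ... | no  x≢x  | yes refl = contradiction refl x≢x

      -- A right inverse of the matrix of eigenvectors is a left inverse
      -- because that matrix has trivial kernel.
      pairing-δ : ∀ l j → pairing l j ≈ ι ⟦ l Finₚ.≟ j ⟧
      pairing-δ l j = x∙y⁻¹≈ε⇒x≈y _ _ (independent difference difference-span j)
        where
        difference : Fin n → Carrier
        difference j = pairing l j - ι ⟦ l Finₚ.≟ j ⟧
        difference-span : ∀ y → Σᴿ.sum (λ j → difference j *ᴿ v j y) ≈ 0#
        difference-span y = begin
          Σᴿ.sum (λ j → difference j *ᴿ v j y)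
            ≈⟨ Σᴿ.sum-cong-≋ (λ j → R.trans (R.distribʳ (v j y) _ _) (R.+-congˡ
                 (R.trans (R.sym (-‿distribˡ-* _ _)) (R.sym (-1*x≈-x _))))) ⟩
          Σᴿ.sum (λ j → pairing l j *ᴿ v j y +ᴿ - 1# *ᴿ (ι ⟦ l Finₚ.≟ j ⟧ *ᴿ v j y))
            ≈⟨ Σᴿ.∑-distrib-+ (λ j → pairing l j *ᴿ v j y)
                              (λ j → - 1# *ᴿ (ι ⟦ l Finₚ.≟ j ⟧ *ᴿ v j y)) ⟩
          Σᴿ.sum (λ j → pairing l j *ᴿ v j y) +ᴿ
          Σᴿ.sum (λ j → - 1# *ᴿ (ι ⟦ l Finₚ.≟ j ⟧ *ᴿ v j y))
            ≈⟨ R.+-cong (pairing-span l y)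
                 (R.trans (R.sym (Σᴿ.*-distribˡ-sum (- 1#) λ j → ι ⟦ l Finₚ.≟ j ⟧ *ᴿ v j y))
                          (R.*-congˡ (sum-ι-δ l λ j → v j y))) ⟩
          v l y +ᴿ - 1# *ᴿ v l y  ≈⟨ R.+-congˡ (-1*x≈-x _) ⟩
          v l y - v l y           ≈⟨ R.-‿inverseʳ _ ⟩
          0#                      ∎

      pairing-diag : ∀ j → pairing j j ≈ 1#
      pairing-diag j with j Finₚ.≟ j | pairing-δ j j
      ... | yes _  | p = R.trans p (×-homo-1 1#)
      ... | no j≢j | _ = contradiction refl j≢j

    -- The trace does not depend on the basis. A factor 1 is expanded as a diagonal entry of
    -- `pairing`, the eigenvalue power times `v j` becomes a matrix power applied to `v j`, and
    -- summing over j first leaves only the diagonal of that power.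
    S≈closedWalks : ∀ i → S i σ ≈ ι (closedWalks G i)
    S≈closedWalks i = begin
      Σᴿ.sum (λ j → ev j ^ i)
        ≈⟨ Σᴿ.sum-cong-≋ (λ j → R.trans (R.sym (R.*-identityʳ _))
             (R.*-congˡ (R.sym (pairing-diag j)))) ⟩
      Σᴿ.sum (λ j → (ev j ^ i) *ᴿ pairing j j)
        ≈⟨ Σᴿ.sum-cong-≋ (λ j → R.trans (Σᴿ.*-distribˡ-sum (ev j ^ i) λ x → v j x *ᴿ dual x j)
             (Σᴿ.sum-cong-≋ λ x → R.sym (R.*-assoc (ev j ^ i) (v j x) (dual x j)))) ⟩
      Σᴿ.sum (λ j → Σᴿ.sum (λ x → ((ev j ^ i) *ᴿ v j x) *ᴿ dual x j))
        ≈⟨ Σᴿ.sum-cong-≋ (λ j → Σᴿ.sum-cong-≋ λ x → R.trans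
             (R.*-congʳ (R.sym (ι-walks-eigen i j x)))
             (R.trans (Σᴿ.*-distribʳ-sum (dual x j) λ y → ι (walks G i x y) *ᴿ v j y)
             (Σᴿ.sum-cong-≋ λ y → R.trans (R.*-assoc (ι (walks G i x y)) (v j y) (dual x j))
                                           (R.*-congˡ (R.*-comm (v j y) (dual x j)))))) ⟩
      Σᴿ.sum (λ j → Σᴿ.sum (λ x → Σᴿ.sum (λ y → ι (walks G i x y) *ᴿ (dual x j *ᴿ v j y))))
        ≈⟨ Σᴿ.∑-comm (λ j x → Σᴿ.sum (λ y → ι (walks G i x y) *ᴿ (dual x j *ᴿ v j y))) ⟩
      Σᴿ.sum (λ x → Σᴿ.sum (λ j → Σᴿ.sum (λ y → ι (walks G i x y) *ᴿ (dual x j *ᴿ v j y))))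
        ≈⟨ Σᴿ.sum-cong-≋ (λ x → Σᴿ.∑-comm (λ j y → ι (walks G i x y) *ᴿ (dual x j *ᴿ v j y))) ⟩
      Σᴿ.sum (λ x → Σᴿ.sum (λ y → Σᴿ.sum (λ j → ι (walks G i x y) *ᴿ (dual x j *ᴿ v j y))))
        ≈⟨ Σᴿ.sum-cong-≋ (λ x → Σᴿ.sum-cong-≋ λ y → R.trans
             (R.sym (Σᴿ.*-distribˡ-sum (ι (walks G i x y)) λ j → dual x j *ᴿ v j y))
             (R.trans (R.*-congˡ (dual-span x y)) (R.*-comm _ _))) ⟩
      Σᴿ.sum (λ x → Σᴿ.sum (λ y → ι ⟦ x Finₚ.≟ y ⟧ *ᴿ ι (walks G i x y)))
        ≈⟨ Σᴿ.sum-cong-≋ (λ x → sum-ι-δ x λ y → ι (walks G i x y)) ⟩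
      Σᴿ.sum (λ x → ι (walks G i x x))
        ≈⟨ ι-sum (λ x → walks G i x x) ⟨
      ι (closedWalks G i) ∎

  -- The index j is found from the graphs alone and hence serves all spectra; strictness survives
  -- because `ι` is strictly increasing.
  closedWalks⇒≺ₛ : ∀ {n} {G H : Graph n} j → 1 ≤ j → j ≤ n ℕ.∸ 1 →
    (∀ i → i < j → closedWalks G i ≡ closedWalks H i) →
    closedWalks G j < closedWalks H j → G ≺ₛ H
  closedWalks⇒≺ₛ j 1≤j j≤n-1 eq lt σ₁ σ₂ =
    j , 1≤j , j≤n-1 ,
    (λ i i<j → R.trans (S≈closedWalks σ₁ i)
                 (R.trans (×-congˡ (eq i i<j)) (R.sym (S≈closedWalks σ₂ i)))) ,
    <-resp-≈ (R.sym (S≈closedWalks σ₁ j)) (R.sym (S≈closedWalks σ₂ j)) (ι-mono-< lt)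

-- Counting

sum-mono-≤ : {f g : Fin n → ℕ} → (∀ i → f i ≤ g i) → sum f ≤ sum g
sum-mono-≤ {zero}  f≤g = z≤n
sum-mono-≤ {suc n} f≤g = ℕₚ.+-mono-≤ (f≤g zero) (sum-mono-≤ (f≤g ∘ suc))

sum-mono-< : {f g : Fin n → ℕ} → (∀ i → f i ≤ g i) → ∀ i → f i < g i → sum f < sum g
sum-mono-< f≤g zero    f<g = ℕₚ.+-mono-<-≤ f<g (sum-mono-≤ (f≤g ∘ suc))
sum-mono-< f≤g (suc i) f<g = ℕₚ.+-mono-≤-< (f≤g zero) (sum-mono-< (f≤g ∘ suc) i f<g)

sum-const-1 : ∀ n → sum {n} (λ _ → 1) ≡ n
sum-const-1 zero    = refl
sum-const-1 (suc n) = cong suc (sum-const-1 n)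

⟦⟧-yes : (P? : Dec P) → P → ⟦ P? ⟧ ≡ 1
⟦⟧-yes (yes _) _ = refl
⟦⟧-yes (no ¬p) p = contradiction p ¬p

⟦⟧-no : (P? : Dec P) → ¬ P → ⟦ P? ⟧ ≡ 0
⟦⟧-no (yes p) ¬p = contradiction p ¬p
⟦⟧-no (no _)  _  = refl

⟦⟧-mono : (P? : Dec P) (Q? : Dec Q) → (P → Q) → ⟦ P? ⟧ ≤ ⟦ Q? ⟧
⟦⟧-mono (no _)  _  _ = z≤n
⟦⟧-mono (yes p) Q? f = ℕₚ.≤-reflexive (sym (⟦⟧-yes Q? (f p)))

⟦⟧-cong : (P? : Dec P) (Q? : Dec Q) → (P → Q) → (Q → P) → ⟦ P? ⟧ ≡ ⟦ Q? ⟧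
⟦⟧-cong P? Q? f g = ℕₚ.≤-antisym (⟦⟧-mono P? Q? f) (⟦⟧-mono Q? P? g)

⟦⟧-× : (P? : Dec P) (Q? : Dec Q) → ⟦ P? ×-dec Q? ⟧ ≡ ⟦ P? ⟧ * ⟦ Q? ⟧
⟦⟧-× (no _)  _       = refl
⟦⟧-× (yes _) (no _)  = refl
⟦⟧-× (yes _) (yes _) = refl

⟦⟧-¬ : (P? : Dec P) → ⟦ P? ⟧ + ⟦ ¬? P? ⟧ ≡ 1
⟦⟧-¬ (yes _) = refl
⟦⟧-¬ (no _)  = refl

⟦⟧-⊎ : (R? : Dec R) (P? : Dec P) (Q? : Dec Q) →
       (R → P ⊎ Q) → (P → R) → (Q → R) → (P → ¬ Q) → ⟦ R? ⟧ ≡ ⟦ P? ⟧ + ⟦ Q? ⟧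
⟦⟧-⊎ R? (yes p) (yes q) _ _   _   disj = contradiction q (disj p)
⟦⟧-⊎ R? (yes p) (no _)  _ p⇒r _   _    = ⟦⟧-yes R? (p⇒r p)
⟦⟧-⊎ R? (no _)  (yes q) _ _   q⇒r _    = ⟦⟧-yes R? (q⇒r q)
⟦⟧-⊎ R? (no ¬p) (no ¬q) split _ _ _    = ⟦⟧-no R? λ r → case-⊥ (split r)
  where
  case-⊥ : ¬ (_ ⊎ _)
  case-⊥ (inj₁ p) = ¬p p
  case-⊥ (inj₂ q) = ¬q q

count : {P : Fin n → Set} → (∀ x → Dec (P x)) → ℕ
count {n} P? = ∑[ x < n ] ⟦ P? x ⟧

count₂ : {P : Fin n → Fin n → Set} → (∀ x y → Dec (P x y)) → ℕ
count₂ {n} P? = ∑[ x < n ] count (P? x)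

sum-δ : (x : Fin n) (f : Fin n → ℕ) → ∑[ y < n ] (⟦ x Finₚ.≟ y ⟧ * f y) ≡ f x
sum-δ {suc n} zero    f =
  trans (cong₂ _+_ (ℕₚ.+-identityʳ (f zero)) (sum-replicate-zero n)) (ℕₚ.+-identityʳ (f zero))
sum-δ {suc n} (suc x) f = sum-δ x (f ∘ suc)

count-≟ : (x : Fin n) → count (λ y → x Finₚ.≟ y) ≡ 1
count-≟ x = trans (sum-cong-≗ λ y → sym (ℕₚ.*-identityʳ ⟦ x Finₚ.≟ y ⟧)) (sum-δ x λ _ → 1)

count-mono : {P Q : Fin n → Set} (P? : ∀ x → Dec (P x)) (Q? : ∀ x → Dec (Q x)) →
             (∀ x → P x → Q x) → count P? ≤ count Q?
count-mono P? Q? f = sum-mono-≤ λ x → ⟦⟧-mono (P? x) (Q? x) (f x)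

count-cong : {P Q : Fin n → Set} (P? : ∀ x → Dec (P x)) (Q? : ∀ x → Dec (Q x)) →
             (∀ x → P x → Q x) → (∀ x → Q x → P x) → count P? ≡ count Q?
count-cong P? Q? f g = sum-cong-≗ λ x → ⟦⟧-cong (P? x) (Q? x) (f x) (g x)

count-≤ : {P : Fin n → Set} (P? : ∀ x → Dec (P x)) → count P? ≤ n
count-≤ {n} P? =
  ℕₚ.≤-trans (sum-mono-≤ λ x → ⟦⟧-mono (P? x) (yes tt) λ _ → tt)
             (ℕₚ.≤-reflexive (sum-const-1 n))

count-none : {P : Fin n → Set} (P? : ∀ x → Dec (P x)) → (∀ x → ¬ P x) → count P? ≡ 0
count-none {n} P? none = trans (sum-cong-≗ λ x → ⟦⟧-no (P? x) (none x)) (sum-replicate-zero n)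

count-¬ : {P : Fin n → Set} (P? : ∀ x → Dec (P x)) → count P? + count (λ x → ¬? (P? x)) ≡ n
count-¬ {n} P? =
  trans (sym (∑-distrib-+ (λ x → ⟦ P? x ⟧) (λ x → ⟦ ¬? (P? x) ⟧)))
        (trans (sum-cong-≗ λ x → ⟦⟧-¬ (P? x)) (sum-const-1 n))

count-⊎ : {R P Q : Fin n → Set} (R? : ∀ x → Dec (R x)) (P? : ∀ x → Dec (P x)) (Q? : ∀ x → Dec (Q x)) →
          (∀ x → R x → P x ⊎ Q x) → (∀ x → P x → R x) → (∀ x → Q x → R x) →
          (∀ x → P x → ¬ Q x) → count R? ≡ count P? + count Q?
count-⊎ R? P? Q? split p⇒r q⇒r disj =
  trans (sum-cong-≗ λ x → ⟦⟧-⊎ (R? x) (P? x) (Q? x) (split x) (p⇒r x) (q⇒r x) (disj x))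
        (∑-distrib-+ (λ x → ⟦ P? x ⟧) (λ x → ⟦ Q? x ⟧))

count₂-⊎ : {R P Q : Fin n → Fin n → Set}
           (R? : ∀ x y → Dec (R x y)) (P? : ∀ x y → Dec (P x y)) (Q? : ∀ x y → Dec (Q x y)) →
           (∀ x y → R x y → P x y ⊎ Q x y) → (∀ x y → P x y → R x y) → (∀ x y → Q x y → R x y) →
           (∀ x y → P x y → ¬ Q x y) → count₂ R? ≡ count₂ P? + count₂ Q?
count₂-⊎ R? P? Q? split p⇒r q⇒r disj =
  trans (sum-cong-≗ λ x → count-⊎ (R? x) (P? x) (Q? x) (split x) (p⇒r x) (q⇒r x) (disj x))
        (∑-distrib-+ (λ x → count (P? x)) (λ x → count (Q? x)))

count₂-swap : {P : Fin n → Fin n → Set} (P? : ∀ x y → Dec (P x y)) →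
              count₂ P? ≡ count₂ (λ x y → P? y x)
count₂-swap P? = ∑-comm λ x y → ⟦ P? x y ⟧

count-unique : {P : Fin n → Set} (P? : ∀ x → Dec (P x)) (Q? : Dec Q) →
               (∀ x → P x → Q) → (Q → ∃[ x ] P x) → (∀ x y → P x → P y → x ≡ y) →
               count P? ≡ ⟦ Q? ⟧
count-unique P? (no ¬q) p⇒q _ _      = count-none P? λ x → ¬q ∘ p⇒q x
count-unique P? (yes q) _ q⇒p unique with q⇒p q
... | x , px = trans (count-cong P? (x Finₚ.≟_) (λ y → unique x y px) (λ { _ refl → px })) (count-≟ x)

sum-fibres : (f : Fin n → Fin r) (g : Fin n → ℕ) →
             sum g ≡ ∑[ l < r ] ∑[ z < n ] (⟦ f z Finₚ.≟ l ⟧ * g z)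
sum-fibres {n} {r} f g =
  trans (sum-cong-≗ λ z → sym (sum-δ (f z) λ _ → g z))
        (∑-comm λ z l → ⟦ f z Finₚ.≟ l ⟧ * g z)

count-fibres : (f : Fin n → Fin r) {P : Fin n → Set} (P? : ∀ x → Dec (P x)) →
               count P? ≡ ∑[ l < r ] count (λ z → (f z Finₚ.≟ l) ×-dec P? z)
count-fibres f P? = trans (sum-fibres f λ z → ⟦ P? z ⟧)
  (sum-cong-≗ λ l → sum-cong-≗ λ z → sym (⟦⟧-× (f z Finₚ.≟ l) (P? z)))

count-bijection : (f : Fin n → Fin r)
  {P : Fin n → Set} (P? : ∀ x → Dec (P x)) {Q : Fin r → Set} (Q? : ∀ l → Dec (Q l)) →
  (∀ z → P z → Q (f z)) → (∀ z w → P z → P w → f z ≡ f w → z ≡ w) →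
  (∀ l → Q l → ∃[ z ] (f z ≡ l × P z)) → count P? ≡ count Q?
count-bijection f P? Q? into inj onto = trans (count-fibres f P?)
  (sum-cong-≗ λ l → count-unique (λ z → (f z Finₚ.≟ l) ×-dec P? z) (Q? l)
    (λ { z (refl , pz) → into z pz }) (onto l)
    (λ { z w (refl , pz) (fw≡fz , pw) → inj z w pz pw (sym fw≡fz) }))

Image : (f : Fin n → Fin r) → (Fin n → Fin n → Set) → Fin r → Fin r → Set
Image f R i j = ∃[ x ] ∃[ y ] (f x ≡ i × f y ≡ j × R x y)

image? : (f : Fin n → Fin r) {R : Fin n → Fin n → Set} (R? : ∀ x y → Dec (R x y)) →
         ∀ i j → Dec (Image f R i j)
image? f R? i j = Finₚ.any? λ x → Finₚ.any? λ y → (f x Finₚ.≟ i) ×-dec (f y Finₚ.≟ j) ×-dec R? x y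

-- The pairs are grouped by the class of the second entry and then by that of the first. By
-- injectivity each fibre holds at most one element, so each fibre count collapses to an indicator.
count₂-image : (f : Fin n → Fin r) {R : Fin n → Fin n → Set} (R? : ∀ x y → Dec (R x y)) →
  (∀ {x y x′ y′} → R x y → R x′ y′ → f x ≡ f x′ → f y ≡ f y′ → x ≡ x′ × y ≡ y′) →
  count₂ R? ≡ count₂ (image? f R?)
count₂-image {n} {r} f R? inj = begin
  ∑[ x < n ] count (R? x)
    ≡⟨ sum-cong-≗ (λ x → count-fibres f (R? x)) ⟩
  ∑[ x < n ] ∑[ j < r ] count (λ y → (f y Finₚ.≟ j) ×-dec R? x y)
    ≡⟨ ∑-comm (λ x j → count (λ y → (f y Finₚ.≟ j) ×-dec R? x y)) ⟩
  ∑[ j < r ] ∑[ x < n ] count (λ y → (f y Finₚ.≟ j) ×-dec R? x y)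
    ≡⟨ sum-cong-≗ (λ j → sum-cong-≗ λ x → count-unique (λ y → (f y Finₚ.≟ j) ×-dec R? x y)
         (section? j x) (λ y p → y , p) (λ p → p)
         (λ { y y′ (refl , p) (q , p′) → proj₂ (inj p p′ refl (sym q)) })) ⟩
  ∑[ j < r ] count (section? j)
    ≡⟨ sum-cong-≗ (λ j → count-fibres f (section? j)) ⟩
  ∑[ j < r ] ∑[ i < r ] count (λ x → (f x Finₚ.≟ i) ×-dec section? j x)
    ≡⟨ ∑-comm (λ j i → count (λ x → (f x Finₚ.≟ i) ×-dec section? j x)) ⟩
  ∑[ i < r ] ∑[ j < r ] count (λ x → (f x Finₚ.≟ i) ×-dec section? j x)
    ≡⟨ sum-cong-≗ (λ i → sum-cong-≗ λ j → count-unique (λ x → (f x Finₚ.≟ i) ×-dec section? j x)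
         (image? f R? i j) (λ { x (p , y , q , s) → x , y , p , q , s })
         (λ { (x , y , p , q , s) → x , p , y , q , s })
         (λ { x x′ (refl , y , refl , s) (p , y′ , q , s′) → proj₁ (inj s s′ (sym p) (sym q)) })) ⟩
  ∑[ i < r ] count (image? f R? i) ∎
  where
  open ≡-Reasoning
  section? = λ j x → Finₚ.any? λ y → (f y Finₚ.≟ j) ×-dec R? x y

count₂-none : {P : Fin n → Fin n → Set} (P? : ∀ x y → Dec (P x y)) → (∀ x y → ¬ P x y) → count₂ P? ≡ 0
count₂-none {n} P? none = trans (sum-cong-≗ λ x → count-none (P? x) (none x)) (sum-replicate-zero n)

count₂-mono-< : {P Q : Fin n → Fin n → Set} (P? : ∀ x y → Dec (P x y)) (Q? : ∀ x y → Dec (Q x y)) →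
  (∀ x y → P x y → Q x y) → ∀ {x y} → ¬ P x y → Q x y → count₂ P? < count₂ Q?
count₂-mono-< P? Q? sub {x} {y} ¬p q =
  sum-mono-< (λ x → count-mono (P? x) (Q? x) (sub x)) x
    (sum-mono-< (λ y → ⟦⟧-mono (P? x y) (Q? x y) (sub x y)) y
      (ℕₚ.≤-reflexive (trans (cong suc (⟦⟧-no (P? x y) ¬p)) (sym (⟦⟧-yes (Q? x y) q)))))

count₂-cong : {P Q : Fin n → Fin n → Set} (P? : ∀ x y → Dec (P x y)) (Q? : ∀ x y → Dec (Q x y)) →
  (∀ x y → P x y → Q x y) → (∀ x y → Q x y → P x y) → count₂ P? ≡ count₂ Q?
count₂-cong P? Q? f g = sum-cong-≗ λ x → count-cong (P? x) (Q? x) (f x) (g x)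

module _ {n : ℕ} where
  open DecMembership (Finₚ._≟_ {n}) using (_∈?_)

  count-∈ : {xs : List (Fin n)} → Unique xs → count (_∈? xs) ≡ length xs
  count-∈ {[]}     []         = count-none (_∈? []) λ _ ()
  count-∈ {x ∷ xs} u@(_ ∷ us) =
    trans (count-⊎ (_∈? (x ∷ xs)) (x Finₚ.≟_) (_∈? xs)
            (λ { _ (here y≡x) → inj₁ (sym y≡x) ; _ (there p) → inj₂ p })
            (λ _ → here ∘ sym) (λ _ → there) (λ { _ refl → Unique[x∷xs]⇒x∉xs u }))
          (cong₂ _+_ (count-≟ x) (count-∈ us))

  -- Serves as a lower bound on the number of vertices: listing distinct ones is enough.
  Unique⇒length≤ : {xs : List (Fin n)} → Unique xs → length xs ≤ n
  Unique⇒length≤ {xs} u = ℕₚ.≤-trans (ℕₚ.≤-reflexive (sym (count-∈ u))) (count-≤ (_∈? xs))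

module _ {n : ℕ} where
  open DecMembership (≡-dec (Finₚ._≟_ {n}) (Finₚ._≟_ {n})) public using () renaming (_∈?_ to _∈ₑ?_)

  count₂-∈ : {es : List (Fin n × Fin n)} → Unique es → count₂ (λ x y → (x , y) ∈ₑ? es) ≡ length es
  count₂-∈ {[]}           []         =
    count₂-none (λ x y → (x , y) ∈ₑ? []) λ _ _ ()
  count₂-∈ {(u , v) ∷ es} U@(_ ∷ Us) =
    trans (count₂-⊎ (λ x y → (x , y) ∈ₑ? ((u , v) ∷ es))
            (λ x y → (u Finₚ.≟ x) ×-dec (v Finₚ.≟ y)) (λ x y → (x , y) ∈ₑ? es)
            (λ { _ _ (here refl) → inj₁ (refl , refl) ; _ _ (there p) → inj₂ p })
            (λ { _ _ (refl , refl) → here refl }) (λ _ _ → there)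
            (λ { _ _ (refl , refl) → Unique[x∷xs]⇒x∉xs U }))
          (cong₂ _+_ single (count₂-∈ Us))
    where
    single : count₂ (λ x y → (u Finₚ.≟ x) ×-dec (v Finₚ.≟ y)) ≡ 1
    single = trans
      (sum-cong-≗ λ x → count-unique (λ y → (u Finₚ.≟ x) ×-dec (v Finₚ.≟ y)) (u Finₚ.≟ x)
        (λ _ → proj₁) (λ p → v , p , refl) (λ { _ _ (_ , refl) (_ , refl) → refl }))
      (count-≟ u)

count-≢-≢ : ∀ {r} {i j : Fin r} → i ≢ j →
            count (λ l → ¬? (i Finₚ.≟ l) ×-dec ¬? (j Finₚ.≟ l)) + 2 ≡ r
count-≢-≢ {r} {i} {j} i≢j = begin
  count neither? + 2                   ≡⟨ cong₂ _+_ (count-cong neither? (λ l → ¬? (either? l))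
                                             (λ _ (¬i , ¬j) → Sum.[ ¬i , ¬j ]) (λ _ ¬e → ¬e ∘ inj₁ , ¬e ∘ inj₂))
                                             (sym two) ⟩
  count (λ l → ¬? (either? l)) + count either?  ≡⟨ ℕₚ.+-comm (count λ l → ¬? (either? l)) _ ⟩
  count either? + count (λ l → ¬? (either? l))  ≡⟨ count-¬ either? ⟩
  r                                    ∎
  where
  open ≡-Reasoning
  neither? = λ l → ¬? (i Finₚ.≟ l) ×-dec ¬? (j Finₚ.≟ l)
  either? = λ l → (i Finₚ.≟ l) ⊎-dec (j Finₚ.≟ l)
  two : count either? ≡ 2
  two = trans (count-⊎ either? (i Finₚ.≟_) (j Finₚ.≟_) (λ _ → id) (λ _ → inj₁) (λ _ → inj₂)
                 λ { _ refl j≡i → i≢j (sym j≡i) })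
              (cong₂ _+_ (count-≟ i) (count-≟ j))

-- Closed walks of length at most four

common? : ∀ {n} (G : Graph n) x y z → Dec (Adj G x z × Adj G z y)
common? G x y z = adj? G x z ×-dec adj? G z y

commonNeighbours : ∀ {n} → Graph n → Fin n → Fin n → ℕ
commonNeighbours G x y = count (common? G x y)

closedWalks-0 : (G : Graph n) → closedWalks G 0 ≡ n
closedWalks-0 {n} G = trans (sum-cong-≗ {n} λ x → ⟦⟧-yes (x Finₚ.≟ x) refl) (sum-const-1 n)

walks-1 : (G : Graph n) → ∀ x y → walks G 1 x y ≡ adjacency G x y
walks-1 G x y = trans
  (sum-cong-≗ λ z → trans (ℕₚ.*-comm (adjacency G x z) _)
    (cong (_* adjacency G x z) (⟦⟧-cong (z Finₚ.≟ y) (y Finₚ.≟ z) sym sym)))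
  (sum-δ y (adjacency G x))

walks-2 : (G : Graph n) → ∀ x y → walks G 2 x y ≡ commonNeighbours G x y
walks-2 G x y = sum-cong-≗ λ z →
  trans (cong (adjacency G x z *_) (walks-1 G z y)) (sym (⟦⟧-× (adj? G x z) (adj? G z y)))

-- Taking two steps at once makes closed walks of length four a sum of squares of common neighbour
-- counts.
walks-+2 : (G : Graph n) → ∀ i x y → walks G (2 + i) x y ≡ ∑[ w < n ] (commonNeighbours G x w * walks G i w y)
walks-+2 {n} G i x y = begin
  ∑[ z < n ] (a x z * ∑[ w < n ] (a z w * walks G i w y))
    ≡⟨ sum-cong-≗ (λ z → *-distribˡ-sum (a x z) λ w → a z w * walks G i w y) ⟩
  ∑[ z < n ] ∑[ w < n ] (a x z * (a z w * walks G i w y))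
    ≡⟨ ∑-comm (λ z w → a x z * (a z w * walks G i w y)) ⟩
  ∑[ w < n ] ∑[ z < n ] (a x z * (a z w * walks G i w y))
    ≡⟨ sum-cong-≗ (λ w → sum-cong-≗ λ z → trans (sym (ℕₚ.*-assoc (a x z) (a z w) _))
         (cong (_* walks G i w y) (sym (⟦⟧-× (adj? G x z) (adj? G z w))))) ⟩
  ∑[ w < n ] ∑[ z < n ] (⟦ common? G x w z ⟧ * walks G i w y)
    ≡⟨ sum-cong-≗ (λ w → sym (*-distribʳ-sum (walks G i w y) λ z → ⟦ common? G x w z ⟧)) ⟩
  ∑[ w < n ] (commonNeighbours G x w * walks G i w y) ∎
  where
  open ≡-Reasoning
  a = adjacency G

common-sym : (G : Graph n) → ∀ x y → commonNeighbours G x y ≡ commonNeighbours G y x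
common-sym G x y = count-cong (common? G x y) (common? G y x)
  (λ _ (xz , zy) → symm G zy , symm G xz) (λ _ (yz , zx) → symm G zx , symm G yz)

degree : Graph n → Fin n → ℕ
degree G x = count (adj? G x)

common-diag : (G : Graph n) → ∀ x → commonNeighbours G x x ≡ degree G x
common-diag G x = count-cong (common? G x x) (adj? G x) (λ _ → proj₁) λ _ a → a , symm G a

closedWalks-1 : (G : Graph n) → closedWalks G 1 ≡ 0
closedWalks-1 {n} G = trans
  (sum-cong-≗ λ x → trans (walks-1 G x x) (⟦⟧-no (adj? G x x) (irrefl G))) (sum-replicate-zero n)

closedWalks-2 : (G : Graph n) → closedWalks G 2 ≡ count₂ (adj? G)
closedWalks-2 G = sum-cong-≗ λ x → trans (walks-2 G x x) (common-diag G x)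

closedWalks-3 : (G : Graph n) → closedWalks G 3 ≡ ∑[ x < n ] ∑[ y < n ] (adjacency G x y * commonNeighbours G x y)
closedWalks-3 G = sum-cong-≗ λ x → sum-cong-≗ λ y →
  cong (adjacency G x y *_) (trans (walks-2 G y x) (common-sym G y x))

closedWalks-4 : (G : Graph n) →
  closedWalks G 4 ≡ ∑[ x < n ] ∑[ y < n ] (commonNeighbours G x y * commonNeighbours G x y)
closedWalks-4 G = sum-cong-≗ λ x → trans (walks-+2 G 2 x x) (sum-cong-≗ λ y →
  cong (commonNeighbours G x y *_) (trans (walks-2 G y x) (common-sym G y x)))

-- Both sides count pairs of edges with a common end.
sum-degree² : (G : Graph n) →
  ∑[ x < n ] (degree G x * degree G x) ≡ ∑[ x < n ] ∑[ y < n ] commonNeighbours G x y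
sum-degree² {n} G = begin
  ∑[ z < n ] (degree G z * degree G z)
    ≡⟨ sum-cong-≗ (λ z → trans (*-distribʳ-sum (degree G z) (a z))
         (sum-cong-≗ λ x → *-distribˡ-sum (a z x) (a z))) ⟩
  ∑[ z < n ] ∑[ x < n ] ∑[ y < n ] (a z x * a z y)
    ≡⟨ ∑-comm (λ z x → ∑[ y < n ] (a z x * a z y)) ⟩
  ∑[ x < n ] ∑[ z < n ] ∑[ y < n ] (a z x * a z y)
    ≡⟨ sum-cong-≗ (λ x → ∑-comm λ z y → a z x * a z y) ⟩
  ∑[ x < n ] ∑[ y < n ] ∑[ z < n ] (a z x * a z y)
    ≡⟨ sum-cong-≗ (λ x → sum-cong-≗ λ y → sum-cong-≗ λ z → trans
         (cong (_* a z y) (⟦⟧-cong (adj? G z x) (adj? G x z) (symm G) (symm G)))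
         (sym (⟦⟧-× (adj? G x z) (adj? G z y)))) ⟩
  ∑[ x < n ] ∑[ y < n ] commonNeighbours G x y ∎
  where
  open ≡-Reasoning
  a = adjacency G

-- Replacing the diagonal squares, which are unbounded individually, by means
-- of sum-degree² makes the fourth moment a sum with a bound on each term.
fourthTerm : Graph n → Fin n → Fin n → ℕ
fourthTerm G x y = commonNeighbours G x y + ⟦ ¬? (x Finₚ.≟ y) ⟧ * (commonNeighbours G x y * commonNeighbours G x y)

closedWalks-4-offDiagonal : (G : Graph n) → closedWalks G 4 ≡ ∑[ x < n ] ∑[ y < n ] fourthTerm G x y
closedWalks-4-offDiagonal {n} G = begin
  closedWalks G 4
    ≡⟨ closedWalks-4 G ⟩
  ∑[ x < n ] ∑[ y < n ] (c x y * c x y)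
    ≡⟨ sum-cong-≗ (λ x → trans (sum-cong-≗ (split x))
         (∑-distrib-+ (λ y → ⟦ x Finₚ.≟ y ⟧ * (c x y * c x y)) (off x))) ⟩
  ∑[ x < n ] (∑[ y < n ] (⟦ x Finₚ.≟ y ⟧ * (c x y * c x y)) + sum (off x))
    ≡⟨ sum-cong-≗ (λ x → cong (_+ sum (off x)) (trans (sum-δ x λ y → c x y * c x y)
         (cong₂ _*_ (common-diag G x) (common-diag G x)))) ⟩
  ∑[ x < n ] (degree G x * degree G x + sum (off x))
    ≡⟨ ∑-distrib-+ (λ x → degree G x * degree G x) (λ x → sum (off x)) ⟩
  ∑[ x < n ] (degree G x * degree G x) + ∑[ x < n ] sum (off x)
    ≡⟨ cong (_+ ∑[ x < n ] sum (off x)) (sum-degree² G) ⟩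
  ∑[ x < n ] sum (c x) + ∑[ x < n ] sum (off x)
    ≡⟨ ∑-distrib-+ (λ x → sum (c x)) (λ x → sum (off x)) ⟨
  ∑[ x < n ] (sum (c x) + sum (off x))
    ≡⟨ sum-cong-≗ (λ x → sym (∑-distrib-+ (c x) (off x))) ⟩
  ∑[ x < n ] ∑[ y < n ] fourthTerm G x y ∎
  where
  open ≡-Reasoning
  c = commonNeighbours G
  off : Fin n → Fin n → ℕ
  off x y = ⟦ ¬? (x Finₚ.≟ y) ⟧ * (c x y * c x y)
  split : ∀ x y → c x y * c x y ≡ ⟦ x Finₚ.≟ y ⟧ * (c x y * c x y) + off x y
  split x y = trans (sym (trans (cong (_* (c x y * c x y)) (⟦⟧-¬ (x Finₚ.≟ y))) (ℕₚ.+-identityʳ _)))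
                    (ℕₚ.*-distribʳ-+ (c x y * c x y) ⟦ x Finₚ.≟ y ⟧ _)

Nonadjacent : Graph n → Rel (Fin n) 0ℓ
Nonadjacent G x y = x ≢ y × ¬ Adj G x y

nonadjacent? : (G : Graph n) → ∀ x y → Dec (Nonadjacent G x y)
nonadjacent? G x y = ¬? (x Finₚ.≟ y) ×-dec ¬? (adj? G x y)

-- Distance at least three.
Far : Graph n → Rel (Fin n) 0ℓ
Far G x y = Nonadjacent G x y × ¬ (∃[ z ] (Adj G x z × Adj G z y))

far? : (G : Graph n) → ∀ x y → Dec (Far G x y)
far? G x y = nonadjacent? G x y ×-dec ¬? (Finₚ.any? (common? G x y))

-- Consequently the number of nonadjacent pairs is fixed by the number of edges.
count₂-≢ : (G : Graph n) →
  count₂ {n} (λ x y → ¬? (x Finₚ.≟ y)) ≡ count₂ (adj? G) + count₂ (nonadjacent? G)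
count₂-≢ G = count₂-⊎ (λ x y → ¬? (x Finₚ.≟ y)) (adj? G) (nonadjacent? G)
  (λ x y x≢y → split x≢y (adj? G x y)) (λ { _ _ a refl → irrefl G a }) (λ _ _ → proj₁) (λ _ _ a (_ , ¬a) → ¬a a)
  where
  split : ∀ {x y} → x ≢ y → Dec (Adj G x y) → Adj G x y ⊎ Nonadjacent G x y
  split x≢y (yes a) = inj₁ a
  split x≢y (no ¬a) = inj₂ (x≢y , ¬a)

-- Bridges

Star-invariant : {A B : Set} {R : Rel A 0ℓ} (s : A → B) → (∀ {x y} → R x y → s x ≡ s y) →
                 ∀ {x y} → Star R x y → s x ≡ s y
Star-invariant s step ε        = refl
Star-invariant s step (e ◅ es) = trans (step e) (Star-invariant s step es)

Star-crossing : ∀ {n r} {R : Rel (Fin n) 0ℓ} (s : Fin n → Fin r) → ∀ {x y} → s x ≢ s y → Star R x y →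
                ∃[ p ] ∃[ q ] (R p q × s p ≢ s q)
Star-crossing s x≁x ε = contradiction refl x≁x
Star-crossing s {x} x≁y (_◅_ {j = z} e es) with s x Finₚ.≟ s z
... | no x≁z  = x , z , e , x≁z
... | yes x~z = Star-crossing s (x≁y ∘ trans x~z) es

firstStep : {A : Set} {R : Rel A 0ℓ} → ∀ {x y} → x ≢ y → Star R x y → ∃[ z ] R x z
firstStep x≢x ε       = contradiction refl x≢x
firstStep _   (e ◅ _) = _ , e

Avoiding : {A : Set} → A → Rel A 0ℓ → Rel A 0ℓ
Avoiding u R p q = R p q × p ≢ u × q ≢ u

-- The path is cut at its last visit to `u`, if there is one; what follows never returns.
lastExit : {R : Rel (Fin n) 0ℓ} (u : Fin n) → ∀ {x y} → y ≢ u → Star R x y →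
           Star (Avoiding u R) x y ⊎ ∃[ b ] (R u b × Star (Avoiding u R) b y)
lastExit u y≢u ε = inj₁ ε
lastExit u {x} y≢u (_◅_ {j = x₁} e es) with lastExit u y≢u es
... | inj₂ exit = inj₂ exit
... | inj₁ path with x Finₚ.≟ u | x₁ Finₚ.≟ u
...   | yes refl | _       = inj₂ (x₁ , e , path)
...   | no x≢u   | no x₁≢u = inj₁ ((e , x≢u , x₁≢u) ◅ path)
...   | no _     | yes refl with path
...     | ε                   = contradiction refl y≢u
...     | (_ , u≢u , _) ◅ _   = contradiction refl u≢u

-- Applied to a path of bridges, this yields a bridge at `x` followed by a path that cannot use that
-- bridge again and so stays on one side of its cut.
leave : {R : Rel (Fin n) 0ℓ} → ∀ {x y} → x ≢ y → Star R x y →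
        ∃[ b ] (R x b × Star (Avoiding x R) b y)
leave {x = x} x≢y path with lastExit x (x≢y ∘ sym) path
... | inj₂ exit                = exit
... | inj₁ ε                   = contradiction refl x≢y
... | inj₁ ((_ , x≢x , _) ◅ _) = contradiction refl x≢x

Fin2-other : {i j k l : Fin 2} → i ≢ j → k ≢ l → i ≡ k → j ≡ l
Fin2-other {i} {zero}     {.i} {zero}     _   _   refl = refl
Fin2-other {i} {suc zero} {.i} {suc zero} _   _   refl = refl
Fin2-other {zero}     {zero}     {_} {suc zero} i≢j _ refl = contradiction refl i≢j
Fin2-other {suc zero} {zero}     {_} {suc zero} _ k≢l refl = contradiction refl k≢l
Fin2-other {zero}     {suc zero} {_} {zero} _ k≢l refl = contradiction refl k≢l
Fin2-other {suc zero} {suc zero} {_} {zero} i≢j _ refl = contradiction refl i≢j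

SameEdge : (x y u v : Fin n) → Set
SameEdge x y u v = (x ≡ u × y ≡ v) ⊎ (x ≡ v × y ≡ u)

-- A two-colouring that changes across this edge only. Any walk that avoids the edge keeps its
-- colour, so a contradiction arises as soon as the ends are joined in another way.
record Cut {n} (G : Graph n) (u v : Fin n) : Set where
  field
    side      : Fin n → Fin 2
    separates : side u ≢ side v
    only      : ∀ {x y} → Adj G x y → ¬ SameEdge x y u v → side x ≡ side y

-- If both ends had the same component, the component map would be constant along every edge of the
-- connected graph, and could not reach both values.
cutEdge⇒cut : {G : Graph n} → Connected G → ∀ {u v} → CutEdge G u v → Cut G u v
cutEdge⇒cut {G = G} connected {u} {v} (_ , comp , onto , comp⇔) = record
  { side      = comp
  ; separates = λ u~v → 0≢1 (trans (sym (proj₂ (onto zero) refl))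
      (trans (Star-invariant comp (constant u~v) (connected _ _)) (proj₂ (onto (suc zero)) refl)))
  ; only      = other
  }
  where
  0≢1 : zero ≢ suc {n = 1} zero
  0≢1 ()
  other : ∀ {x y} → Adj G x y → ¬ SameEdge x y u v → comp x ≡ comp y
  other a ¬uv = Equivalence.from (comp⇔ _ _) ((a , ¬uv) ◅ ε)
  constant : comp u ≡ comp v → ∀ {x y} → Adj G x y → comp x ≡ comp y
  constant u~v {x} {y} a with ((x Finₚ.≟ u) ×-dec (y Finₚ.≟ v)) ⊎-dec ((x Finₚ.≟ v) ×-dec (y Finₚ.≟ u))
  ... | yes (inj₁ (refl , refl)) = u~v
  ... | yes (inj₂ (refl , refl)) = sym u~v
  ... | no ¬uv                   = other a ¬uv

cut-sym : {G : Graph n} → ∀ {u v} → Cut G u v → Cut G v u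
cut-sym c = record { side = side ; separates = separates ∘ sym ; only = λ a ¬vu → only a (¬vu ∘ Sum.swap) }
  where open Cut c

-- Contracting the bridges

mergeClass : {a b : Fin (suc r)} → a ≢ b → Fin (suc r) → Fin r
mergeClass {a = a} a≢b c with a Finₚ.≟ c
... | yes _  = punchOut a≢b
... | no a≢c = punchOut a≢c

mergeClass-merges : {a b : Fin (suc r)} (a≢b : a ≢ b) → mergeClass a≢b a ≡ mergeClass a≢b b
mergeClass-merges {a = a} {b} a≢b with a Finₚ.≟ a | a Finₚ.≟ b
... | no a≢a | _      = contradiction refl a≢a
... | yes _  | yes a≡b = contradiction a≡b a≢b
... | yes _  | no _    = Finₚ.punchOut-cong a refl

-- The map drops the index `a` and sends it to the new place of `b`; on all other indices it is the
-- injective `punchOut`.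
mergeClass-injective : {a b : Fin (suc r)} (a≢b : a ≢ b) → ∀ {c d} →
  mergeClass a≢b c ≡ mergeClass a≢b d → c ≡ d ⊎ SameEdge c d a b
mergeClass-injective {a = a} {b} a≢b {c} {d} eq with a Finₚ.≟ c | a Finₚ.≟ d
... | yes refl | yes refl = inj₁ refl
... | yes refl | no a≢d   = inj₂ (inj₁ (refl , sym (Finₚ.punchOut-injective a≢b a≢d eq)))
... | no a≢c   | yes refl = inj₂ (inj₂ (Finₚ.punchOut-injective a≢c a≢b eq , refl))
... | no a≢c   | no a≢d   = inj₁ (Finₚ.punchOut-injective a≢c a≢d eq)

mergeClass-onto : {a b : Fin (suc r)} (a≢b : a ≢ b) → ∀ i → mergeClass a≢b (punchIn a i) ≡ i
mergeClass-onto {a = a} a≢b i with a Finₚ.≟ punchIn a i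
... | yes a≡ = contradiction (sym a≡) (Finₚ.punchInᵢ≢i a i)
... | no _   = trans (Finₚ.punchOut-cong a refl) (Finₚ.punchOut-punchIn a)

EdgeIn : List (Fin n × Fin n) → Rel (Fin n) 0ℓ
EdgeIn es x y = (x , y) ∈ es ⊎ (y , x) ∈ es

-- The connected components of the graph with edge list `es`. Keeping their number as an index `r`
-- lets two graphs with equally many bridges share it.
record Classes {n} (es : List (Fin n × Fin n)) (r : ℕ) : Set where
  field
    class     : Fin n → Fin r
    adjacent  : ∀ {x y} → EdgeIn es x y → class x ≡ class y
    connects  : ∀ {x y} → class x ≡ class y → Star (EdgeIn es) x y
    onto      : ∀ i → ∃[ x ] class x ≡ i

-- Each bridge joins two different classes of the bridges inserted before it.
bridgeClasses : {G : Graph n} (es : List (Fin n × Fin n)) → Unique es →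
  (∀ {u v} → (u , v) ∈ es → u Fin.< v × Adj G u v × Cut G u v) →
  ∃[ r ] (r + length es ≡ n × Classes es r)
bridgeClasses {n} [] _ _ = n , ℕₚ.+-identityʳ n , record
  { class = id ; adjacent = λ { (inj₁ ()) ; (inj₂ ()) } ; connects = λ { refl → ε } ; onto = λ i → i , refl }
bridgeClasses {n} {G} ((u , v) ∷ es) U@(_ ∷ Us) bridge with bridgeClasses {G = G} es Us (bridge ∘ there)
... | r₁ , size , cl = merged r₁ size cl
  where
  open Cut (proj₂ (proj₂ (bridge (here refl))))

  -- `(u , v)` cannot recur because the list is duplicate-free, and `(v , u)` cannot occur because
  -- every listed pair is increasing. Hence walks inside an old class never cross the cut of the new
  -- bridge.
  new : ∀ {x y} → EdgeIn es x y → ¬ SameEdge x y u v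
  new (inj₁ p) (inj₁ (refl , refl)) = Unique[x∷xs]⇒x∉xs U p
  new (inj₂ p) (inj₂ (refl , refl)) = Unique[x∷xs]⇒x∉xs U p
  new (inj₁ p) (inj₂ (refl , refl)) = Finₚ.<-asym (proj₁ (bridge (here refl))) (proj₁ (bridge (there p)))
  new (inj₂ p) (inj₁ (refl , refl)) = Finₚ.<-asym (proj₁ (bridge (here refl))) (proj₁ (bridge (there p)))

  adj : ∀ {x y} → EdgeIn es x y → Adj G x y
  adj (inj₁ p) = proj₁ (proj₂ (bridge (there p)))
  adj (inj₂ p) = symm G (proj₁ (proj₂ (bridge (there p))))

  weaken : ∀ {x y} → Star (EdgeIn es) x y → Star (EdgeIn ((u , v) ∷ es)) x y
  weaken = Star.map (Sum.map there there)

  merged : ∀ r₁ → r₁ + length es ≡ n → Classes es r₁ →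
           ∃[ r ] (r + suc (length es) ≡ n × Classes ((u , v) ∷ es) r)
  merged zero     size cl = contradiction (Classes.class cl u) λ ()
  merged (suc r₁) size cl = r₁ , trans (ℕₚ.+-suc r₁ _) size , record
    { class    = mergeClass u≁v ∘ class
    ; adjacent = λ
      { (inj₁ (here refl)) → mergeClass-merges u≁v
      ; (inj₂ (here refl)) → sym (mergeClass-merges u≁v)
      ; (inj₁ (there p))   → cong (mergeClass u≁v) (adjacent (inj₁ p))
      ; (inj₂ (there p))   → cong (mergeClass u≁v) (adjacent (inj₂ p)) }
    ; connects = reach ∘ mergeClass-injective u≁v
    ; onto     = λ i → proj₁ (onto (punchIn (class u) i)) ,
        trans (cong (mergeClass u≁v) (proj₂ (onto (punchIn (class u) i)))) (mergeClass-onto u≁v i)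
    }
    where
    open Classes cl
    u≁v : class u ≢ class v
    u≁v eq = separates (Star-invariant side (λ e → only (adj e) (new e)) (connects eq))
    reach : ∀ {x y} → class x ≡ class y ⊎ SameEdge (class x) (class y) (class u) (class v) →
            Star (EdgeIn ((u , v) ∷ es)) x y
    reach (inj₁ x~y)               = weaken (connects x~y)
    reach (inj₂ (inj₁ (x~u , y~v))) =
      weaken (connects x~u) ◅◅ inj₁ (here refl) ◅ weaken (connects (sym y~v))
    reach (inj₂ (inj₂ (x~v , y~u))) =
      weaken (connects x~v) ◅◅ inj₂ (here refl) ◅ weaken (connects (sym y~u))

-- Permutations sorting a decidable predicate

toℕ-punchIn-last : ∀ {n} (y : Fin n) → toℕ (punchIn (Fin.fromℕ n) y) ≡ toℕ y
toℕ-punchIn-last zero    = refl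
toℕ-punchIn-last (suc y) = cong suc (toℕ-punchIn-last y)

-- The clique of `K` is an initial segment of the vertex numbers, so an isomorphism has to move a
-- set there. Vertex zero keeps its place if it belongs to the set and goes to the last place
-- otherwise, which lies beyond the count.
sortPermutation : ∀ {n} {P : Fin n → Set} (P? : ∀ x → Dec (P x)) →
  Σ (Permutation′ n) λ π → ∀ x → P x ⇔ toℕ (π ⟨$⟩ʳ x) < count P?
sortPermutation {zero}  P? = Perm.id , λ ()
sortPermutation {suc n} P? with P? zero | sortPermutation (P? ∘ suc)
... | yes p | π , sorted = Perm.lift₀ π , λ
  { zero    → mk⇔ (λ _ → s≤s z≤n) (λ _ → p)
  ; (suc x) → mk⇔ (s≤s ∘ Equivalence.to (sorted x)) (λ { (s≤s lt) → Equivalence.from (sorted x) lt }) }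
... | no ¬p | π , sorted = Perm.insert zero (Fin.fromℕ n) π , λ
  { zero    → mk⇔ (λ p → contradiction p ¬p) λ lt → contradiction (count-≤ (P? ∘ suc))
                (ℕₚ.<⇒≱ (subst (_< count (P? ∘ suc)) (Finₚ.toℕ-fromℕ n) lt))
  ; (suc x) → mk⇔ (subst (_< count (P? ∘ suc)) (sym (toℕ-insert x)) ∘ Equivalence.to (sorted x))
                  (Equivalence.from (sorted x) ∘ subst (_< count (P? ∘ suc)) (toℕ-insert x)) }
  where
  toℕ-insert : ∀ x → toℕ (Perm.insert zero (Fin.fromℕ n) π ⟨$⟩ʳ suc x) ≡ toℕ (π ⟨$⟩ʳ x)
  toℕ-insert x = trans (cong toℕ (Perm.insert-punchIn zero (Fin.fromℕ n) π x)) (toℕ-punchIn-last (π ⟨$⟩ʳ x))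

transpose-first : ∀ {n} (i j : Fin n) → PC.transpose i j i ≡ j
transpose-first i j with i Finₚ.≟ i
... | yes _  = refl
... | no i≢i = contradiction refl i≢i

transpose-< : ∀ {n c} {i j : Fin n} → toℕ i < c → toℕ j < c → ∀ k → toℕ k < c ⇔ toℕ (PC.transpose i j k) < c
transpose-< {i = i} {j} i<c j<c k with k Finₚ.≟ i
... | yes refl = mk⇔ (λ _ → j<c) (λ _ → i<c)
... | no _ with k Finₚ.≟ j
...   | yes refl = mk⇔ (λ _ → i<c) (λ _ → j<c)
...   | no _     = mk⇔ id id

-- After sorting, the place of `h` is exchanged with place 0. Both places lie below the count, so
-- the sorting is not disturbed.
sortPermutation-at : ∀ {n} {P : Fin n → Set} (P? : ∀ x → Dec (P x)) {h : Fin n} → P h →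
  Σ (Permutation′ n) λ π →
    (∀ x → P x ⇔ toℕ (π ⟨$⟩ʳ x) < count P?) × (∀ x → x ≡ h ⇔ toℕ (π ⟨$⟩ʳ x) ≡ 0)
sortPermutation-at {suc n} P? {h} ph with sortPermutation P?
... | ρ , sorted = π , (λ x → swapped x ⇔-∘ sorted x) , λ x → mk⇔
        (λ { refl → cong toℕ h↦0 })
        (λ x↦0 → π-injective (trans (Finₚ.toℕ-injective x↦0) (sym h↦0)))
  where
  π : Permutation′ (suc n)
  π = ρ ∘ₚ Perm.transpose (ρ ⟨$⟩ʳ h) zero
  h↦0 : π ⟨$⟩ʳ h ≡ zero
  h↦0 = transpose-first (ρ ⟨$⟩ʳ h) zero
  π-injective : ∀ {x y} → π ⟨$⟩ʳ x ≡ π ⟨$⟩ʳ y → x ≡ y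
  π-injective eq = trans (sym (Perm.inverseˡ π)) (trans (cong (π ⟨$⟩ˡ_) eq) (Perm.inverseˡ π))
  h<count : toℕ (ρ ⟨$⟩ʳ h) < count P?
  h<count = Equivalence.to (sorted h) ph
  swapped : ∀ x → toℕ (ρ ⟨$⟩ʳ x) < count P? ⇔ toℕ (π ⟨$⟩ʳ x) < count P?
  swapped x = transpose-< h<count (ℕₚ.≤-<-trans z≤n h<count) (ρ ⟨$⟩ʳ x)

-- Classes of vertices joined by bridges

module BridgeStructure {n r} (G : Graph n) (connected : Connected G)
  {es : List (Fin n × Fin n)} (unique : Unique es)
  (cutEdges : ∀ u v → (u , v) ∈ es ⇔ (u Fin.< v × CutEdge G u v))
  (classes : Classes es r) where

  open Classes classes

  Bridge : Rel (Fin n) 0ℓ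
  Bridge = EdgeIn es

  bridge? : ∀ x y → Dec (Bridge x y)
  bridge? x y = ((x , y) ∈ₑ? es) ⊎-dec ((y , x) ∈ₑ? es)

  bridge-sym : ∀ {x y} → Bridge x y → Bridge y x
  bridge-sym = Sum.swap

  bridge⇒adj : ∀ {x y} → Bridge x y → Adj G x y
  bridge⇒adj (inj₁ p) = proj₁ (proj₂ (Equivalence.to (cutEdges _ _) p))
  bridge⇒adj (inj₂ p) = symm G (proj₁ (proj₂ (Equivalence.to (cutEdges _ _) p)))

  bridge⇒cut : ∀ {x y} → Bridge x y → Cut G x y
  bridge⇒cut (inj₁ p) = cutEdge⇒cut connected (proj₂ (Equivalence.to (cutEdges _ _) p))
  bridge⇒cut (inj₂ p) = cut-sym (cutEdge⇒cut connected (proj₂ (Equivalence.to (cutEdges _ _) p)))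

  -- The edges that are not cut edges, which are those lying on a cycle.
  Cyclic : Rel (Fin n) 0ℓ
  Cyclic x y = Adj G x y × ¬ Bridge x y

  cyclic? : ∀ x y → Dec (Cyclic x y)
  cyclic? x y = adj? G x y ×-dec ¬? (bridge? x y)

  cyclic-sym : ∀ {x y} → Cyclic x y → Cyclic y x
  cyclic-sym (a , ¬b) = symm G a , ¬b ∘ bridge-sym

  bridge-irrefl : ∀ {x} → ¬ Bridge x x
  bridge-irrefl = irrefl G ∘ bridge⇒adj

  -- Otherwise a bridge from x towards z would lie on a cycle through y and w.
  detour : ∀ {x y z w} → class x ≡ class z → Cyclic x y → Cyclic z w → w ≢ x →
           Star (Avoiding x (Adj G)) w y → x ≡ z
  detour {x} {y} {z} {w} x~z (xy , ¬bxy) (zw , _) w≢x path with x Finₚ.≟ z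
  ... | yes x≡z = x≡z
  ... | no  x≢z with leave x≢z (connects x~z)
  ...   | b , xb , b⇝z = contradiction
          (trans (only xy λ { (inj₁ (_ , refl)) → ¬bxy xb
                                 ; (inj₂ (refl , _)) → bridge-irrefl xb })
          (trans (sym (keep path))
                 (trans (sym (only zw λ { (inj₁ (z≡x , _)) → x≢z (sym z≡x)
                                        ; (inj₂ (_ , w≡x)) → w≢x w≡x }))
                        (sym (keep (Star.map (λ (e , p≢x , q≢x) → bridge⇒adj e , p≢x , q≢x) b⇝z))))))
          separates
    where
    open Cut (bridge⇒cut xb)
    keep : ∀ {p q} → Star (Avoiding x (Adj G)) p q → side p ≡ side q
    keep = Star-invariant side λ (a , p≢x , q≢x) → only a λ
      { (inj₁ (p≡x , _)) → p≢x p≡x ; (inj₂ (_ , q≡x)) → q≢x q≡x }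

  -- Otherwise a path of bridges from `x` to `y` starts with some bridge to `b` other than the given
  -- edge; this edge together with the rest of the path joins the two ends of that bridge around it.
  cyclic⇒class≢ : ∀ {x y} → Cyclic x y → class x ≢ class y
  cyclic⇒class≢ {x} {y} (xy , ¬bxy) x~y with leave (λ { refl → irrefl G xy }) (connects x~y)
  ... | b , xb , b⇝y = separates
      (trans (only xy λ { (inj₁ (_ , refl)) → ¬bxy xb ; (inj₂ (refl , _)) → bridge-irrefl xb })
             (sym (Star-invariant side (λ (e , p≢x , q≢x) → only (bridge⇒adj e) λ
               { (inj₁ (p≡x , _)) → p≢x p≡x ; (inj₂ (_ , q≡x)) → q≢x q≡x }) b⇝y)))
    where open Cut (bridge⇒cut xb)

  classPath : ∀ {x p q} → class p ≡ class q → class p ≢ class x → Star (Avoiding x (Adj G)) p q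
  classPath {x} p~q p≁x = go p≁x (connects p~q)
    where
    go : ∀ {p q} → class p ≢ class x → Star Bridge p q → Star (Avoiding x (Adj G)) p q
    go p≁x ε        = ε
    go p≁x (e ◅ es) = (bridge⇒adj e , p≁x ∘ cong class , q≁x ∘ cong class) ◅ go q≁x es
      where q≁x = λ q~x → p≁x (trans (adjacent e) q~x)

  -- The detour from `y′` to `y` runs inside their common class, which does not contain `x`.
  cyclic-uniqueˡ : ∀ {x y x′ y′} → Cyclic x y → Cyclic x′ y′ →
                   class x ≡ class x′ → class y ≡ class y′ → x ≡ x′
  cyclic-uniqueˡ {x} {y} {x′} {y′} xy x′y′ x~x′ y~y′ =
    detour x~x′ xy x′y′ (y′≁x ∘ cong class) (classPath (sym y~y′) y′≁x)
    where
    y′≁x : class y′ ≢ class x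
    y′≁x y′~x = cyclic⇒class≢ xy (sym (trans y~y′ y′~x))

  cyclic-unique : ∀ {x y x′ y′} → Cyclic x y → Cyclic x′ y′ →
                  class x ≡ class x′ → class y ≡ class y′ → x ≡ x′ × y ≡ y′
  cyclic-unique xy x′y′ x~x′ y~y′ =
    cyclic-uniqueˡ xy x′y′ x~x′ y~y′ , cyclic-uniqueˡ (cyclic-sym xy) (cyclic-sym x′y′) y~y′ x~x′

  bridge-noTriangle : ∀ {x y z} → Bridge x y → Adj G x z → ¬ Adj G z y
  bridge-noTriangle {x} {y} {z} xy xz zy = separates
    (trans (only xz λ { (inj₁ (_ , refl)) → irrefl G zy ; (inj₂ (refl , _)) → bridge-irrefl xy })
           (only zy λ { (inj₁ (refl , _)) → irrefl G xz ; (inj₂ (_ , refl)) → bridge-irrefl xy }))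
    where open Cut (bridge⇒cut xy)

  -- The three other sides would join the ends of the bridge; the two inequalities ensure that none
  -- of them is the bridge itself.
  bridge-noSquare : ∀ {x y z w} → Bridge x y → Adj G y z → Adj G z w → Adj G w x →
                    z ≢ x → w ≢ y → ⊥
  bridge-noSquare {x} {y} {z} {w} xy yz zw wx z≢x w≢y = separates
    (sym (trans (only yz λ { (inj₁ (refl , _)) → bridge-irrefl xy ; (inj₂ (_ , z≡x)) → z≢x z≡x })
         (trans (only zw λ { (inj₁ (z≡x , _)) → z≢x z≡x
                           ; (inj₂ (_ , w≡x)) → irrefl G (subst (λ w → Adj G w x) w≡x wx) })
                (only wx λ { (inj₁ (refl , _)) → irrefl G wx ; (inj₂ (w≡y , _)) → w≢y w≡y }))))
    where open Cut (bridge⇒cut xy)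

  crossing⇒cyclic : ∀ {x y} → Adj G x y → class x ≢ class y → Cyclic x y
  crossing⇒cyclic a x≁y = a , x≁y ∘ adjacent

  private
    crossing⇒cutEdge : {p q : Fin n} → Adj G p q → class p ≢ class q → r ≡ 2 → CutEdge G p q
    crossing⇒cutEdge {p} {q} pq p≁q refl =
      pq , class , (λ i → proj₁ (onto i) , λ { refl → proj₂ (onto i) }) , λ x y → mk⇔ stay leaves
      where
      crossing-unique : ∀ {x y} → Adj G x y → class x ≢ class y → SameEdge x y p q
      crossing-unique {x} {y} xy x≁y with class x Finₚ.≟ class p
      ... | yes x~p = inj₁ (cyclic-unique (crossing⇒cyclic xy x≁y) (crossing⇒cyclic pq p≁q) x~p
                             (Fin2-other x≁y p≁q x~p))
      ... | no x≁p  = inj₂ (cyclic-unique (crossing⇒cyclic xy x≁y) (crossing⇒cyclic (symm G pq) (p≁q ∘ sym)) x~q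
                             (Fin2-other x≁y (p≁q ∘ sym) x~q))
        where x~q = Fin2-other (x≁p ∘ sym) p≁q refl
      stay : ∀ {x y} → class x ≡ class y → Reachable (deleteEdge G p q) x y
      stay = Star.map (λ e → bridge⇒adj e , λ
        { (inj₁ (refl , refl)) → p≁q (adjacent e) ; (inj₂ (refl , refl)) → p≁q (sym (adjacent e)) }) ∘ connects
      leaves : ∀ {x y} → Reachable (deleteEdge G p q) x y → class x ≡ class y
      leaves = Star-invariant class λ {x} {y} (xy , ¬pq) →
        decidable-stable (class x Finₚ.≟ class y) (¬pq ∘ crossing-unique xy)

  -- Between two classes there would be exactly one edge outside the bridges,
  -- and the classes would be the components left by its deletion.
  classCount≢2 : r ≢ 2
  classCount≢2 refl with Star-crossing class zero≁one (connected (proj₁ (onto zero)) (proj₁ (onto (suc zero))))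
    where
    zero≁one : class (proj₁ (onto zero)) ≢ class (proj₁ (onto (suc zero)))
    zero≁one eq with trans (sym (proj₂ (onto zero))) (trans eq (proj₂ (onto (suc zero))))
    ... | ()
  ... | p , q , pq , p≁q with Finₚ.<-cmp p q
  ...   | tri< p<q _ _  = p≁q (adjacent (inj₁ (Equivalence.from (cutEdges p q)
                            (p<q , crossing⇒cutEdge pq p≁q refl))))
  ...   | tri≈ _ refl _ = p≁q refl
  ...   | tri> _ _ q<p  = p≁q (adjacent (inj₂ (Equivalence.from (cutEdges q p)
                            (q<p , crossing⇒cutEdge (symm G pq) (p≁q ∘ sym) refl))))

  -- The number of edges and the case of equality

  Full : Set
  Full = ∀ i j → i ≢ j → Image class Cyclic i j

  full⊎missing : Full ⊎ ∃[ i ] ∃[ j ] (i ≢ j × ¬ Image class Cyclic i j)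
  full⊎missing with Finₚ.any? (λ i → Finₚ.any? λ j → ¬? (i Finₚ.≟ j) ×-dec ¬? (image? class cyclic? i j))
  ... | yes missing = inj₂ missing
  ... | no ¬missing = inj₁ λ i j i≢j →
          decidable-stable (image? class cyclic? i j) λ ¬ij → ¬missing (i , j , i≢j , ¬ij)

  count₂-bridge : count₂ bridge? ≡ length es + length es
  count₂-bridge = trans
    (count₂-⊎ bridge? (λ x y → (x , y) ∈ₑ? es) (λ x y → (y , x) ∈ₑ? es) (λ _ _ → id) (λ _ _ → inj₁) (λ _ _ → inj₂)
      λ x y p q → Finₚ.<-asym (proj₁ (Equivalence.to (cutEdges x y) p)) (proj₁ (Equivalence.to (cutEdges y x) q)))
    (cong₂ _+_ (count₂-∈ unique) (trans (count₂-swap (λ x y → (y , x) ∈ₑ? es)) (count₂-∈ unique)))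

  count₂-adj : count₂ (adj? G) ≡ length es + length es + count₂ cyclic?
  count₂-adj = trans
    (count₂-⊎ (adj? G) bridge? cyclic? (λ x y a → split a (bridge? x y)) (λ _ _ → bridge⇒adj) (λ _ _ → proj₁)
      λ _ _ b (_ , ¬b) → ¬b b)
    (cong (_+ count₂ cyclic?) count₂-bridge)
    where
    split : ∀ {x y} → Adj G x y → Dec (Bridge x y) → Bridge x y ⊎ Cyclic x y
    split a (yes b) = inj₁ b
    split a (no ¬b) = inj₂ (a , ¬b)

  image⇒≢ : ∀ i j → Image class Cyclic i j → i ≢ j
  image⇒≢ i j (x , y , refl , refl , xy) = cyclic⇒class≢ xy

  -- By `cyclic-unique` the cyclic edges inject into pairs of distinct classes, and the pair
  -- `(i , j)` is not hit. All counts are of ordered pairs, hence twice the number of edges.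
  missing⇒count₂-cyclic< : ∀ {i j} → i ≢ j → ¬ Image class Cyclic i j →
    count₂ cyclic? < count₂ {r} (λ i j → ¬? (i Finₚ.≟ j))
  missing⇒count₂-cyclic< i≢j ¬ij = ℕₚ.≤-<-trans
    (ℕₚ.≤-reflexive (count₂-image class cyclic? cyclic-unique))
    (count₂-mono-< (image? class cyclic?) (λ i j → ¬? (i Finₚ.≟ j)) image⇒≢ ¬ij i≢j)

  module _ (full : Full) where

    full⇒count₂-cyclic : count₂ cyclic? ≡ count₂ {r} (λ i j → ¬? (i Finₚ.≟ j))
    full⇒count₂-cyclic = trans (count₂-image class cyclic? cyclic-unique)
      (count₂-cong (image? class cyclic?) (λ i j → ¬? (i Finₚ.≟ j)) image⇒≢ full)

    -- If the far ends lie in different classes, the cyclic edge between those two classes completes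
    -- a detour from `w` to `y` that stays outside the class of `x`. So each class has a single
    -- vertex from which its cyclic edges leave.
    cyclic-source : ∀ {x y z w} → Cyclic x y → Cyclic z w → class x ≡ class z → x ≡ z
    cyclic-source {x} {y} {z} {w} xy zw x~z with class y Finₚ.≟ class w
    ... | yes y~w = cyclic-uniqueˡ xy zw x~z y~w
    ... | no y≁w with full (class y) (class w) y≁w
    ...   | p , q , p~y , q~w , pq , _ =
            detour x~z xy zw (w≁x ∘ cong class)
              (classPath (sym q~w) w≁x ◅◅
               (symm G pq , (λ { refl → w≁x (sym q~w) }) , (λ { refl → y≁x (sym p~y) })) ◅
               classPath p~y (λ p~x → y≁x (trans (sym p~y) p~x)))
      where
      w≁x : class w ≢ class x
      w≁x w~x = cyclic⇒class≢ zw (sym (trans w~x x~z))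
      y≁x : class y ≢ class x
      y≁x = cyclic⇒class≢ xy ∘ sym

    -- The edge that joins the two classes must start and end at their unique sources, which are `x`
    -- and `z`.
    cyclic-between : ∀ {x y z w} → Cyclic x y → Cyclic z w → x ≢ z → Cyclic x z
    cyclic-between {x} {y} {z} {w} xy zw x≢z with full (class x) (class z) (x≢z ∘ cyclic-source xy zw)
    ... | p , q , p~x , q~z , pq
        with cyclic-source pq xy p~x | cyclic-source (cyclic-sym pq) zw q~z
    ...   | refl | refl = pq

    -- A triangle contains no bridge, so `class` matches the common neighbours with the classes
    -- other than those of `x` and `y`; the sources of these classes provide surjectivity.
    common-cyclic : ∀ {x y} → Cyclic x y → commonNeighbours G x y ≡ r ∸ 2
    common-cyclic {x} {y} xy = trans (sym (ℕₚ.m+n∸n≡m (commonNeighbours G x y) 2)) (cong (_∸ 2) (trans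
      (cong (_+ 2) (count-bijection class (common? G x y) (λ l → ¬? (class x Finₚ.≟ l) ×-dec ¬? (class y Finₚ.≟ l))
        (λ z (xz , zy) → cyclic⇒class≢ (edge xz zy) , cyclic⇒class≢ (edge′ xz zy))
        (λ z w (xz , zy) (xw , wy) → proj₂ ∘ cyclic-unique (edge xz zy) (edge xw wy) refl)
        onto′))
      (count-≢-≢ (cyclic⇒class≢ xy))))
      where
      edge : ∀ {z} → Adj G x z → Adj G z y → Cyclic x z
      edge xz zy = xz , λ b → bridge-noTriangle b (proj₁ xy) (symm G zy)
      edge′ : ∀ {z} → Adj G x z → Adj G z y → Cyclic y z
      edge′ xz zy = symm G zy , λ b → bridge-noTriangle b (symm G (proj₁ xy)) xz
      onto′ : ∀ l → class x ≢ l × class y ≢ l → ∃[ z ] (class z ≡ l × Adj G x z × Adj G z y)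
      onto′ l (x≁l , y≁l) with full (class x) l x≁l | full (class y) l y≁l
      ... | p , q , p~x , q~l , pq | p′ , q′ , p′~y , q′~l , p′q′
          with cyclic-source pq xy p~x | cyclic-source p′q′ (cyclic-sym xy) p′~y
             | cyclic-source (cyclic-sym pq) (cyclic-sym p′q′) (trans q~l (sym q′~l))
      ...   | refl | refl | refl = q , q~l , proj₁ pq , symm G (proj₁ p′q′)

    -- Two common neighbours would form a square. Its edges are not bridges, so `x` and `y` would
    -- both lie on cyclic edges and be adjacent by `cyclic-between`.
    common-nonadjacent : ∀ {x y} → x ≢ y → ¬ Adj G x y →
                         commonNeighbours G x y ≡ ⟦ Finₚ.any? (common? G x y) ⟧
    common-nonadjacent {x} {y} x≢y ¬xy =
      count-unique (common? G x y) (Finₚ.any? (common? G x y)) (λ z c → z , c) id same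
      where
      same : ∀ z w → Adj G x z × Adj G z y → Adj G x w × Adj G w y → z ≡ w
      same z w (xz , zy) (xw , wy) = decidable-stable (z Finₚ.≟ w) λ z≢w →
        ¬xy (proj₁ (cyclic-between
          (xz , λ b → bridge-noSquare b zy (symm G wy) (symm G xw) (x≢y ∘ sym) (z≢w ∘ sym))
          (symm G zy , λ b → bridge-noSquare b (symm G xz) xw wy x≢y (z≢w ∘ sym))
          x≢y))

  -- Third and fourth moments in the case of equality

  common-bridge : ∀ {x y} → Bridge x y → commonNeighbours G x y ≡ 0
  common-bridge {x} {y} xy = count-none (common? G x y) λ _ (xz , zy) → bridge-noTriangle xy xz zy

  module _ (full : Full) where
    private
      c : Fin n → Fin n → ℕ
      c = commonNeighbours G
      -- With a single class the subtraction is truncated, but then there are no cyclic edges to be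
      -- weighted by `q`.
      q : ℕ
      q = r ∸ 2

    full⇒closedWalks-3 : closedWalks G 3 ≡ count₂ cyclic? * q
    full⇒closedWalks-3 = begin
      closedWalks G 3
        ≡⟨ closedWalks-3 G ⟩
      ∑[ x < n ] ∑[ y < n ] (adjacency G x y * c x y)
        ≡⟨ sum-cong-≗ (λ x → trans (sum-cong-≗ (term x)) (sym (*-distribʳ-sum q λ y → ⟦ cyclic? x y ⟧))) ⟩
      ∑[ x < n ] (count (cyclic? x) * q)
        ≡⟨ *-distribʳ-sum q (λ x → count (cyclic? x)) ⟨
      count₂ cyclic? * q ∎
      where
      open ≡-Reasoning
      term : ∀ x y → adjacency G x y * c x y ≡ ⟦ cyclic? x y ⟧ * q
      term x y = cases (adj? G x y) (bridge? x y)
        where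
        cases : Dec (Adj G x y) → Dec (Bridge x y) → adjacency G x y * c x y ≡ ⟦ cyclic? x y ⟧ * q
        cases (no ¬a) _ = trans (cong (_* c x y) (⟦⟧-no (adj? G x y) ¬a))
                                (cong (_* q) (sym (⟦⟧-no (cyclic? x y) (¬a ∘ proj₁))))
        cases (yes a) (yes b) = trans (trans (cong (adjacency G x y *_) (common-bridge b))
                                             (ℕₚ.*-zeroʳ (adjacency G x y)))
                                      (cong (_* q) (sym (⟦⟧-no (cyclic? x y) λ (_ , ¬b) → ¬b b)))
        cases (yes a) (no ¬b) = cong₂ _*_ (trans (⟦⟧-yes (adj? G x y) a) (sym (⟦⟧-yes (cyclic? x y) (a , ¬b))))
                                          (common-cyclic full (a , ¬b))

    -- What `fourthTerm` would be without far pairs: the degree on the diagonal, q + q² on a cyclic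
    -- edge, 0 on a bridge and 1 + 1² = 2 on a nonadjacent pair.
    fourthBound : Fin n → Fin n → ℕ
    fourthBound x y = ⟦ x Finₚ.≟ y ⟧ * c x y + (⟦ cyclic? x y ⟧ * (q + q * q) + ⟦ nonadjacent? G x y ⟧ * 2)

    sum-fourthBound : ∑[ x < n ] ∑[ y < n ] fourthBound x y ≡
      count₂ (adj? G) + (count₂ cyclic? * (q + q * q) + count₂ (nonadjacent? G) * 2)
    sum-fourthBound = begin
      ∑[ x < n ] ∑[ y < n ] fourthBound x y
        ≡⟨ sum-cong-≗ (λ x → trans (∑-distrib-+ (λ y → ⟦ x Finₚ.≟ y ⟧ * c x y) _)
             (cong₂ _+_ (trans (sum-δ x (c x)) (common-diag G x))
               (trans (∑-distrib-+ (λ y → ⟦ cyclic? x y ⟧ * (q + q * q)) _)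
                 (cong₂ _+_ (sym (*-distribʳ-sum (q + q * q) λ y → ⟦ cyclic? x y ⟧))
                            (sym (*-distribʳ-sum 2 λ y → ⟦ nonadjacent? G x y ⟧)))))) ⟩
      ∑[ x < n ] (degree G x + (count (cyclic? x) * (q + q * q) + count (nonadjacent? G x) * 2))
        ≡⟨ trans (∑-distrib-+ (degree G) _) (cong (count₂ (adj? G) +_)
             (trans (∑-distrib-+ (λ x → count (cyclic? x) * (q + q * q)) _)
               (cong₂ _+_ (sym (*-distribʳ-sum (q + q * q) λ x → count (cyclic? x)))
                          (sym (*-distribʳ-sum 2 λ x → count (nonadjacent? G x)))))) ⟩
      count₂ (adj? G) + (count₂ cyclic? * (q + q * q) + count₂ (nonadjacent? G) * 2) ∎
      where open ≡-Reasoning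

    fourthTerm-defect : ∀ x y → fourthTerm G x y + ⟦ far? G x y ⟧ * 2 ≡ fourthBound x y
    fourthTerm-defect x y = cases (x Finₚ.≟ y) (adj? G x y) (bridge? x y) (Finₚ.any? (common? G x y))
      where
      -- Substitutes the values of all five indicators at once, so that each case is left with plain
      -- arithmetic in `c x y`.
      with-indicators : ∀ {i j k l m} →
        ⟦ ¬? (x Finₚ.≟ y) ⟧ ≡ i → ⟦ far? G x y ⟧ ≡ j →
        ⟦ x Finₚ.≟ y ⟧ ≡ k → ⟦ cyclic? x y ⟧ ≡ l → ⟦ nonadjacent? G x y ⟧ ≡ m →
        c x y + i * (c x y * c x y) + j * 2 ≡ k * c x y + (l * (q + q * q) + m * 2) →
        fourthTerm G x y + ⟦ far? G x y ⟧ * 2 ≡ fourthBound x y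
      with-indicators refl refl refl refl refl eq = eq
      cases : Dec (x ≡ y) → Dec (Adj G x y) → Dec (Bridge x y) → Dec (∃[ z ] (Adj G x z × Adj G z y)) →
              fourthTerm G x y + ⟦ far? G x y ⟧ * 2 ≡ fourthBound x y
      cases (yes refl) _ _ _ = with-indicators
        (⟦⟧-no (¬? (x Finₚ.≟ x)) λ x≢x → x≢x refl) (⟦⟧-no (far? G x x) λ ((x≢x , _) , _) → x≢x refl)
        (⟦⟧-yes (x Finₚ.≟ x) refl) (⟦⟧-no (cyclic? x x) λ (a , _) → irrefl G a)
        (⟦⟧-no (nonadjacent? G x x) λ (x≢x , _) → x≢x refl) refl
      cases (no x≢y) (yes a) (yes b) _ = with-indicators
        (⟦⟧-yes (¬? (x Finₚ.≟ y)) x≢y) (⟦⟧-no (far? G x y) λ ((_ , ¬a) , _) → ¬a a)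
        (⟦⟧-no (x Finₚ.≟ y) x≢y) (⟦⟧-no (cyclic? x y) λ (_ , ¬b) → ¬b b)
        (⟦⟧-no (nonadjacent? G x y) λ (_ , ¬a) → ¬a a)
        (cong (λ c → c + 1 * (c * c) + 0) (common-bridge b))
      cases (no x≢y) (yes a) (no ¬b) _ = with-indicators
        (⟦⟧-yes (¬? (x Finₚ.≟ y)) x≢y) (⟦⟧-no (far? G x y) λ ((_ , ¬a) , _) → ¬a a)
        (⟦⟧-no (x Finₚ.≟ y) x≢y) (⟦⟧-yes (cyclic? x y) (a , ¬b))
        (⟦⟧-no (nonadjacent? G x y) λ (_ , ¬a) → ¬a a)
        (cong (_+ 0) (trans (cong (λ c → c + 1 * (c * c)) (common-cyclic full (a , ¬b)))
                            (sym (ℕₚ.+-assoc q (q * q) 0))))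
      cases (no x≢y) (no ¬a) _ (yes z) = with-indicators
        (⟦⟧-yes (¬? (x Finₚ.≟ y)) x≢y) (⟦⟧-no (far? G x y) λ (_ , ¬z) → ¬z z)
        (⟦⟧-no (x Finₚ.≟ y) x≢y) (⟦⟧-no (cyclic? x y) λ (a , _) → ¬a a)
        (⟦⟧-yes (nonadjacent? G x y) (x≢y , ¬a))
        (cong (λ c → c + 1 * (c * c) + 0)
              (trans (common-nonadjacent full x≢y ¬a) (⟦⟧-yes (Finₚ.any? (common? G x y)) z)))
      cases (no x≢y) (no ¬a) _ (no ¬z) = with-indicators
        (⟦⟧-yes (¬? (x Finₚ.≟ y)) x≢y) (⟦⟧-yes (far? G x y) ((x≢y , ¬a) , ¬z))
        (⟦⟧-no (x Finₚ.≟ y) x≢y) (⟦⟧-no (cyclic? x y) λ (a , _) → ¬a a)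
        (⟦⟧-yes (nonadjacent? G x y) (x≢y , ¬a))
        (cong (λ c → c + 1 * (c * c) + 2)
              (trans (common-nonadjacent full x≢y ¬a) (⟦⟧-no (Finₚ.any? (common? G x y)) ¬z)))

    -- Each far pair falls short of its bound by exactly 2. The right side depends only on n and k,
    -- so the fourth moment is decided by the number of far pairs.
    full⇒closedWalks-4 : closedWalks G 4 + count₂ (far? G) * 2 ≡
      count₂ (adj? G) + (count₂ cyclic? * (q + q * q) + count₂ (nonadjacent? G) * 2)
    full⇒closedWalks-4 = begin
      closedWalks G 4 + count₂ (far? G) * 2
        ≡⟨ cong₂ _+_ (closedWalks-4-offDiagonal G) (trans (*-distribʳ-sum 2 λ x → count (far? G x))
             (sum-cong-≗ λ x → *-distribʳ-sum 2 λ y → ⟦ far? G x y ⟧)) ⟩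
      ∑[ x < n ] ∑[ y < n ] fourthTerm G x y + ∑[ x < n ] ∑[ y < n ] (⟦ far? G x y ⟧ * 2)
        ≡⟨ trans (sum-cong-≗ λ x → ∑-distrib-+ (fourthTerm G x) λ y → ⟦ far? G x y ⟧ * 2)
                 (∑-distrib-+ (λ x → sum (fourthTerm G x)) _) ⟨
      ∑[ x < n ] ∑[ y < n ] (fourthTerm G x y + ⟦ far? G x y ⟧ * 2)
        ≡⟨ sum-cong-≗ (λ x → sum-cong-≗ (fourthTerm-defect x)) ⟩
      ∑[ x < n ] ∑[ y < n ] fourthBound x y
        ≡⟨ sum-fourthBound ⟩
      count₂ (adj? G) + (count₂ cyclic? * (q + q * q) + count₂ (nonadjacent? G) * 2) ∎
      where open ≡-Reasoning

  -- Distances at most two and universal vertices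

  Universal : Fin n → Set
  Universal h = ∀ w → w ≢ h → Adj G h w

  module _ (near : ∀ x y → ¬ Far G x y) where

    near′ : ∀ {x y} → x ≢ y → ¬ Adj G x y → ∃[ z ] (Adj G x z × Adj G z y)
    near′ {x} {y} x≢y ¬xy = decidable-stable (Finₚ.any? (common? G x y)) λ ¬z → near x y ((x≢y , ¬xy) , ¬z)

    module _ {u v} (c : Cut G u v) (uv : Adj G u v) where
      open Cut c

      inner-only : ∀ {x y} → x ≢ u → x ≢ v → Adj G x y → side x ≡ side y
      inner-only x≢u x≢v xy = only xy λ { (inj₁ (x≡u , _)) → x≢u x≡u ; (inj₂ (x≡v , _)) → x≢v x≡v }

      -- A common neighbour of `w` and `v` lies on the side of `w`, which is the side of `u`; the
      -- only neighbour of `v` there is `u`.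
      sameSide⇒adj : ∀ {w} → w ≢ u → side w ≡ side u → Adj G u w
      sameSide⇒adj {w} w≢u w~u = decidable-stable (adj? G u w) λ ¬uw →
        let v≢w = λ { refl → ¬uw uv }
            w≁v = λ w~v → separates (trans (sym w~u) w~v)
            z , vz , zw = near′ v≢w (λ vw → w≁v (inner-only w≢u (v≢w ∘ sym) (symm G vw)))
        in w≁v (trans (inner-only w≢u (v≢w ∘ sym) (symm G zw))
                      (sym (only vz λ { (inj₁ (v≡u , _)) → irrefl G (subst (Adj G u) v≡u uv)
                                      ; (inj₂ (_ , z≡u)) → ¬uw (subst (λ z → Adj G z w) z≡u zw) })))

    -- A vertex not adjacent to `u` lies on the side of `v`, and one not adjacent to `v` on the side
    -- of `u`. Two such vertices are inner vertices of opposite sides and therefore have no common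
    -- neighbour.
    universal-end : ∀ {u v} → Bridge u v → Universal u ⊎ Universal v
    universal-end {u} {v} uv with Finₚ.any? (λ w → ¬? (w Finₚ.≟ u) ×-dec ¬? (adj? G u w))
    ... | no all = inj₁ λ w w≢u → decidable-stable (adj? G u w) λ ¬uw → all (w , w≢u , ¬uw)
    ... | yes (w , w≢u , ¬uw) = inj₂ λ x x≢v → decidable-stable (adj? G v x) λ ¬vx →
            let x≁v = ¬vx ∘ sameSide⇒adj (cut-sym cut) vu x≢v
                w≁u = ¬uw ∘ sameSide⇒adj cut (bridge⇒adj uv) w≢u
                w≢v = λ { refl → ¬uw (bridge⇒adj uv) }
                x≢u = λ { refl → ¬vx vu }
                x≁w = λ x~w → x≁v (trans x~w (Fin2-other (w≁u ∘ sym) separates refl))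
                z , xz , zw = near′ (x≁w ∘ cong side) (x≁w ∘ inner-only cut (bridge⇒adj uv) x≢u x≢v)
            in x≁w (trans (inner-only cut (bridge⇒adj uv) x≢u x≢v xz)
                          (sym (inner-only cut (bridge⇒adj uv) w≢u w≢v (symm G zw))))
      where
      cut = bridge⇒cut uv
      vu = symm G (bridge⇒adj uv)
      open Cut cut

    -- With a bridge, one of its ends will do. Without bridges all classes are singletons, so the
    -- graph is complete and any vertex will do.
    universal-vertex : Full → Fin n → ∃[ h ] Universal h
    universal-vertex full x with Finₚ.any? (λ u → Finₚ.any? (bridge? u))
    ... | yes (u , v , uv) with universal-end uv
    ...   | inj₁ all = u , all
    ...   | inj₂ all = v , all
    universal-vertex full x | no ¬bridge = x , λ w w≢x → adjacent-to w≢x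
      where
      discrete : ∀ {x y} → class x ≡ class y → x ≡ y
      discrete x~y with connects x~y
      ... | ε     = refl
      ... | e ◅ _ = contradiction (_ , _ , e) ¬bridge
      adjacent-to : ∀ {w} → w ≢ x → Adj G x w
      adjacent-to {w} w≢x with full (class x) (class w) (w≢x ∘ sym ∘ discrete)
      ... | p , q , p~x , q~w , pq with discrete p~x | discrete q~w
      ...   | refl | refl = proj₁ pq

  module _ (full : Full) {h : Fin n} (universal : Universal h) where

    -- A bridge that misses `h` would form a triangle with it.
    bridge-at : ∀ {x y} → Bridge x y → x ≡ h ⊎ y ≡ h
    bridge-at {x} {y} xy with x Finₚ.≟ h | y Finₚ.≟ h
    ... | yes x≡h | _       = inj₁ x≡h
    ... | no _    | yes y≡h = inj₂ y≡h
    ... | no x≢h  | no y≢h  =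
            contradiction (universal y y≢h) (bridge-noTriangle xy (symm G (universal x x≢h)))

    -- The future clique; it contains `h` itself, and the other vertices become the pendants.
    core? : ∀ x → Dec (¬ Bridge h x)
    core? x = ¬? (bridge? h x)

    core-singleton : ∀ {x y} → x ≢ h → ¬ Bridge h x → class x ≡ class y → x ≡ y
    core-singleton x≢h ¬hx x~y with connects x~y
    ... | ε = refl
    ... | e ◅ _ with bridge-at e
    ...   | inj₁ x≡h  = contradiction x≡h x≢h
    ...   | inj₂ refl = contradiction (bridge-sym e) ¬hx

    -- The class of `h` consists of `h` and all pendants and is represented by `h`; a core vertex
    -- other than `h` meets no bridge and is a class of its own.
    count-core : count core? ≡ r
    count-core = trans
      (count-bijection class core? {Q = λ _ → ⊤} (λ _ → yes tt) (λ _ _ → tt) injective surjective)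
      (sum-const-1 r)
      where
      injective : ∀ x y → ¬ Bridge h x → ¬ Bridge h y → class x ≡ class y → x ≡ y
      injective x y ¬hx ¬hy x~y with x Finₚ.≟ h | y Finₚ.≟ h
      ... | no x≢h   | _        = core-singleton x≢h ¬hx x~y
      ... | yes _    | no y≢h   = sym (core-singleton y≢h ¬hy (sym x~y))
      ... | yes refl | yes refl = refl
      surjective : ∀ l → ⊤ → ∃[ x ] (class x ≡ l × ¬ Bridge h x)
      surjective l _ with onto l
      ... | x , x~l with bridge? h x
      ...   | yes hx = h , trans (adjacent hx) x~l , bridge-irrefl
      ...   | no ¬hx = x , x~l , ¬hx

    core-adjacent : ∀ {x y} → x ≢ y → ¬ Bridge h x → ¬ Bridge h y → Adj G x y
    core-adjacent {x} {y} x≢y ¬hx ¬hy with x Finₚ.≟ h | y Finₚ.≟ h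
    ... | yes refl | _        = universal y (x≢y ∘ sym)
    ... | no x≢h   | yes refl = symm G (universal x x≢h)
    ... | no x≢h   | no y≢h with full (class x) (class y) (x≢y ∘ core-singleton x≢h ¬hx)
    ...   | p , q , p~x , q~y , pq
            with core-singleton x≢h ¬hx (sym p~x) | core-singleton y≢h ¬hy (sym q~y)
    ...     | refl | refl = proj₁ pq

    -- A vertex joined to `h` by a bridge has no other neighbour, since that neighbour is adjacent
    -- to `h` and would close a triangle on the bridge.
    adj-cases : ∀ {x y} → Adj G x y →
      (¬ Bridge h x × ¬ Bridge h y) ⊎ (x ≡ h × Bridge h y) ⊎ (y ≡ h × Bridge h x)
    adj-cases {x} {y} xy with bridge? h x | bridge? h y
    ... | no ¬hx | no ¬hy = inj₁ (¬hx , ¬hy)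
    ... | yes hx | _ with y Finₚ.≟ h
    ...   | yes y≡h = inj₂ (inj₂ (y≡h , hx))
    ...   | no y≢h  = contradiction (symm G xy) (bridge-noTriangle hx (universal y y≢h))
    adj-cases {x} {y} xy | no _ | yes hy with x Finₚ.≟ h
    ...   | yes x≡h = inj₂ (inj₁ (x≡h , hy))
    ...   | no x≢h  = contradiction xy (bridge-noTriangle hy (universal x x≢h))

    universal⇒≅K : ∀ k → n ∸ k ≡ r → G ≅ K n k
    universal⇒≅K k n∸k≡r with sortPermutation-at core? {h} bridge-irrefl
    ... | π , sorted , atZero = π , λ x y → mk⇔ to from
      where
      below : ∀ {x} → ¬ Bridge h x → toℕ (π ⟨$⟩ʳ x) < n ∸ k
      below {x} ¬hx = subst (toℕ (π ⟨$⟩ʳ x) <_) (trans count-core (sym n∸k≡r)) (Equivalence.to (sorted x) ¬hx)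
      core : ∀ {x} → toℕ (π ⟨$⟩ʳ x) < n ∸ k → ¬ Bridge h x
      core {x} lt = Equivalence.from (sorted x) (subst (toℕ (π ⟨$⟩ʳ x) <_) (trans n∸k≡r (sym count-core)) lt)
      above : ∀ {x} → Bridge h x → n ∸ k ≤ toℕ (π ⟨$⟩ʳ x)
      above hx = ℕₚ.≮⇒≥ λ lt → core lt hx
      to : ∀ {x y} → Adj G x y → Adj (K n k) (π ⟨$⟩ʳ x) (π ⟨$⟩ʳ y)
      to {x} {y} xy = distinct , joined (adj-cases xy)
        where
        distinct : π ⟨$⟩ʳ x ≢ π ⟨$⟩ʳ y
        distinct eq with trans (sym (Perm.inverseˡ π)) (trans (cong (π ⟨$⟩ˡ_) eq) (Perm.inverseˡ π))
        ... | refl = irrefl G xy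
        joined : (¬ Bridge h x × ¬ Bridge h y) ⊎ (x ≡ h × Bridge h y) ⊎ (y ≡ h × Bridge h x) → _
        joined (inj₁ (¬hx , ¬hy))       = inj₁ (below ¬hx , below ¬hy)
        joined (inj₂ (inj₁ (x≡h , hy))) = inj₂ (inj₁ (Equivalence.to (atZero x) x≡h , above hy))
        joined (inj₂ (inj₂ (y≡h , hx))) = inj₂ (inj₂ (Equivalence.to (atZero y) y≡h , above hx))
      from : ∀ {x y} → Adj (K n k) (π ⟨$⟩ʳ x) (π ⟨$⟩ʳ y) → Adj G x y
      from {x} {y} (πx≢πy , joined) = go joined
        where
        x≢y : x ≢ y
        x≢y = πx≢πy ∘ cong (π ⟨$⟩ʳ_)
        go : _ → Adj G x y
        go (inj₁ (x< , y<)) = core-adjacent x≢y (core x<) (core y<)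
        go (inj₂ (inj₁ (x↦0 , _))) with Equivalence.from (atZero x) x↦0
        ... | refl = universal y (x≢y ∘ sym)
        go (inj₂ (inj₂ (y↦0 , _))) with Equivalence.from (atZero y) y↦0
        ... | refl = symm G (universal x x≢y)

  -- Enough vertices for the fourth moment to count

  far⇒4≤n : ∀ {x y} → Far G x y → 4 ≤ n
  far⇒4≤n {x} {y} ((x≢y , ¬xy) , ¬z)
    with firstStep x≢y (connected x y) | firstStep (x≢y ∘ sym) (connected y x)
  ... | x′ , xx′ | y′ , yy′ = Unique⇒length≤ {xs = x ∷ x′ ∷ y′ ∷ y ∷ []}
    ( ((λ { refl → irrefl G xx′ }) ∷ (λ { refl → ¬xy (symm G yy′) }) ∷ x≢y ∷ [])
    ∷ ((λ { refl → ¬z (x′ , xx′ , symm G yy′) }) ∷ (λ { refl → ¬xy xx′ }) ∷ [])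
    ∷ ((λ { refl → irrefl G yy′ }) ∷ [])
    ∷ [] ∷ [])

  module _ (full : Full) where

    OnCycle : Fin n → Set
    OnCycle x = ∃[ y ] Cyclic x y

    onCycle-adjacent : ∀ {x y} → OnCycle x → OnCycle y → x ≢ y → Adj G x y
    onCycle-adjacent (_ , xz) (_ , yw) x≢y = proj₁ (cyclic-between full xz yw x≢y)

    -- Vertices on cyclic edges are pairwise adjacent, so the two are not both of this kind. If just
    -- one is, a neighbour of the other is not either, as it would be a common neighbour.
    far⇒offCycle : ∀ {x y} → Far G x y → ∃[ u ] ∃[ v ] (u ≢ v × ¬ OnCycle u × ¬ OnCycle v)
    far⇒offCycle {x} {y} ((x≢y , ¬xy) , ¬z) with Finₚ.any? (cyclic? x) | Finₚ.any? (cyclic? y)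
    ... | yes cx | yes cy = contradiction (onCycle-adjacent cx cy x≢y) ¬xy
    ... | no ¬cx | no ¬cy = x , y , x≢y , ¬cx , ¬cy
    ... | no ¬cx | yes cy with firstStep x≢y (connected x y)
    ...   | x′ , xx′ = x , x′ , (λ { refl → irrefl G xx′ }) , ¬cx ,
            λ cx′ → ¬z (x′ , xx′ , onCycle-adjacent cx′ cy λ { refl → ¬xy xx′ })
    far⇒offCycle {x} {y} ((x≢y , ¬xy) , ¬z) | yes cx | no ¬cy with firstStep (x≢y ∘ sym) (connected y x)
    ...   | y′ , yy′ = y , y′ , (λ { refl → irrefl G yy′ }) , ¬cy ,
            λ cy′ → ¬z (y′ , onCycle-adjacent cx cy′ (λ { refl → ¬xy (symm G yy′) }) , symm G yy′)

  -- Three vertices on cyclic edges, taken from the classes 0, 1 and 2, come on top of two vertices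
  -- off all cyclic edges.
  far⇒5≤n-manyClasses : (full : Full) → ∀ {s} → r ≡ 3 + s → ∀ {x y} → Far G x y → 5 ≤ n
  far⇒5≤n-manyClasses full refl far
    with far⇒offCycle full far | full zero (suc zero) (λ ()) | full (suc (suc zero)) zero (λ ())
  ... | u , v , u≢v , ¬cu , ¬cv | p , q , p~0 , q~1 , pq | t , t′ , t~2 , _ , tt′ =
    Unique⇒length≤ {xs = u ∷ v ∷ p ∷ q ∷ t ∷ []}
    ( (u≢v ∷ (λ { refl → ¬cu (_ , pq) }) ∷ (λ { refl → ¬cu (_ , cyclic-sym pq) }) ∷ (λ { refl → ¬cu (_ , tt′) }) ∷ [])
    ∷ ((λ { refl → ¬cv (_ , pq) }) ∷ (λ { refl → ¬cv (_ , cyclic-sym pq) }) ∷ (λ { refl → ¬cv (_ , tt′) }) ∷ [])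
    ∷ ((λ { refl → 0≢1 (trans (sym p~0) q~1) }) ∷ (λ { refl → 0≢2 (trans (sym p~0) t~2) }) ∷ [])
    ∷ ((λ { refl → 1≢2 (trans (sym q~1) t~2) }) ∷ [])
    ∷ [] ∷ [])
    where
    0≢1 : _≢_ {A = Fin (3 + _)} zero (suc zero)
    0≢1 ()
    0≢2 : _≢_ {A = Fin (3 + _)} zero (suc (suc zero))
    0≢2 ()
    1≢2 : _≢_ {A = Fin (3 + _)} (suc zero) (suc (suc zero))
    1≢2 ()

  -- A single class means k = n - 1, so the graph is a tree; with four vertices it would fall under
  -- the excluded pair, where the path has the same S₀ to S₃ as the star.
  far⇒5≤n : Full → ∀ {k} → r + k ≡ n → ¬ (n ≡ 4 × k ≡ 3) → ∀ {x y} → Far G x y → 5 ≤ n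
  far⇒5≤n full {k} size n,k≢4,3 {x} far = cases r refl
    where
    cases : ∀ s → r ≡ s → 5 ≤ n
    cases 0 r≡0 = contradiction (subst Fin r≡0 (class x)) λ ()
    cases 1 r≡1 = ℕₚ.≤∧≢⇒< (far⇒4≤n far) λ 4≡n → n,k≢4,3
      (sym 4≡n , ℕₚ.suc-injective (trans (cong (_+ k) (sym r≡1)) (trans size (sym 4≡n))))
    cases 2 r≡2 = contradiction r≡2 classCount≢2
    cases (suc (suc (suc s))) r≡3+s = far⇒5≤n-manyClasses full r≡3+s far

-- The graph K n k

-- The bound 3 keeps the vertex inside every clique of at least three vertices.
third-vertex : ∀ {m} (u v : Fin (3 + m)) → ∃[ w ] (toℕ w < 3 × u ≢ w × v ≢ w)
third-vertex zero          (suc zero)    = suc (suc zero) , s≤s (s≤s (s≤s z≤n)) , (λ ()) , λ ()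
third-vertex zero          zero          = suc zero , s≤s (s≤s z≤n) , (λ ()) , λ ()
third-vertex zero          (suc (suc _)) = suc zero , s≤s (s≤s z≤n) , (λ ()) , λ ()
third-vertex (suc zero)    zero          = suc (suc zero) , s≤s (s≤s (s≤s z≤n)) , (λ ()) , λ ()
third-vertex (suc (suc _)) zero          = suc zero , s≤s (s≤s z≤n) , (λ ()) , λ ()
third-vertex (suc _)       (suc _)       = zero , s≤s z≤n , (λ ()) , λ ()

-- Writing the order as `suc r + k` encodes k < n, gives the clique `suc r` vertices and provides
-- the vertex `zero` that carries the pendants.
module KGraph (r k : ℕ) where

  private
    H : Graph (suc r + k)
    H = K (suc r + k) k

    size : suc r + k ∸ k ≡ suc r
    size = ℕₚ.m+n∸n≡m (suc r) k

  K-clique : ∀ {x y} → x ≢ y → toℕ x < suc r → toℕ y < suc r → Adj H x y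
  K-clique {x} {y} x≢y x<r y<r = x≢y , inj₁ (subst (toℕ x <_) (sym size) x<r , subst (toℕ y <_) (sym size) y<r)

  K-universal : ∀ {y} → zero ≢ y → Adj H zero y
  K-universal {y} 0≢y with toℕ y ℕₚ.<? suc r
  ... | yes y<r = K-clique 0≢y (s≤s z≤n) y<r
  ... | no  y≮r = 0≢y , inj₂ (inj₁ (refl , subst (_≤ toℕ y) (sym size) (ℕₚ.≮⇒≥ y≮r)))

  pendant≢0 : ∀ {y : Fin (suc r + k)} → suc r ≤ toℕ y → zero ≢ y
  pendant≢0 () refl

  K-pendant-neighbour : ∀ {x y} → suc r ≤ toℕ y → Adj H x y → x ≡ zero
  K-pendant-neighbour {x} {y} r≤y (_ , inj₁ (_ , y<r)) = contradiction r≤y (ℕₚ.<⇒≱ (subst (toℕ y <_) size y<r))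
  K-pendant-neighbour r≤y (_ , inj₂ (inj₁ (x≡0 , _))) = Finₚ.toℕ-injective x≡0
  K-pendant-neighbour r≤y (_ , inj₂ (inj₂ (y≡0 , _))) =
    contradiction (sym (Finₚ.toℕ-injective {j = zero} y≡0)) (pendant≢0 r≤y)

  private
    to-0 : ∀ x → Star (Adj H) x zero
    to-0 x with zero Finₚ.≟ x
    ... | yes refl = ε
    ... | no 0≢x   = symm H (K-universal 0≢x) ◅ ε

  K-connected : Connected H
  K-connected x y = to-0 x ◅◅ Star.reverse (symm H) (to-0 y)

  -- The components after deletion are `j` alone and all the rest, which is still joined through
  -- `zero`.
  K-pendant-cutEdge : ∀ {j} → suc r ≤ toℕ j → CutEdge H zero j
  K-pendant-cutEdge {j} r≤j = K-universal 0≢j , comp , onto , λ x y → mk⇔ (joined x y) (Star-invariant comp invariant)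
    where
    0≢j = pendant≢0 r≤j
    comp : Fin (suc r + k) → Fin 2
    comp w with w Finₚ.≟ j
    ... | yes _ = suc zero
    ... | no  _ = zero
    comp-≢ : ∀ {w} → w ≢ j → comp w ≡ zero
    comp-≢ {w} w≢j with w Finₚ.≟ j
    ... | yes w≡j = contradiction w≡j w≢j
    ... | no  _   = refl
    comp-j : comp j ≡ suc zero
    comp-j with j Finₚ.≟ j
    ... | yes _  = refl
    ... | no j≢j = contradiction refl j≢j
    onto : ∀ i → ∃[ x ] (∀ {z} → z ≡ x → comp z ≡ i)
    onto zero       = zero , λ { refl → comp-≢ 0≢j }
    onto (suc zero) = j , λ { refl → comp-j }
    reach-0 : ∀ {x} → x ≢ j → Reachable (deleteEdge H zero j) x zero
    reach-0 {x} x≢j with zero Finₚ.≟ x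
    ... | yes refl = ε
    ... | no 0≢x   = (symm H (K-universal 0≢x) ,
                      λ { (inj₁ (x≡0 , _)) → 0≢x (sym x≡0) ; (inj₂ (x≡j , _)) → x≢j x≡j }) ◅ ε
    joined : ∀ x y → comp x ≡ comp y → Reachable (deleteEdge H zero j) x y
    joined x y eq with x Finₚ.≟ j | y Finₚ.≟ j
    ... | yes refl | yes refl = ε
    ... | no x≢j   | no y≢j   = reach-0 x≢j ◅◅ Star.reverse (symm (deleteEdge H zero j)) (reach-0 y≢j)
    joined x y () | yes _ | no _
    joined x y () | no _  | yes _
    invariant : ∀ {x y} → Adj (deleteEdge H zero j) x y → comp x ≡ comp y
    invariant {x} {y} (xy , ¬0j) with x Finₚ.≟ j | y Finₚ.≟ j
    ... | yes _    | yes _    = refl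
    ... | no _     | no _     = refl
    ... | yes refl | no _     = contradiction (inj₂ (refl , K-pendant-neighbour r≤j (symm H xy))) ¬0j
    ... | no _     | yes refl = contradiction (inj₁ (K-pendant-neighbour r≤j xy , refl)) ¬0j

  module _ (r≢1 : r ≢ 1) where

    -- An edge in the clique gives r ≥ 1, hence r ≥ 2, and a third clique vertex puts the edge in a
    -- triangle.
    K-clique-¬cutEdge : ∀ {u v} → u Fin.< v → toℕ v < suc r → ¬ CutEdge H u v
    K-clique-¬cutEdge {u} {v} u<v (s≤s v≤r) cut = large r≢1 (ℕₚ.<-≤-trans (ℕₚ.≤-<-trans z≤n u<v) v≤r) refl
      where
      large : ∀ {s} → s ≢ 1 → 0 < s → s ≢ r
      large {suc zero}    s≢1 _ _    = s≢1 refl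
      large {suc (suc s)} _   _ refl with third-vertex u v
      ... | w , w<3 , u≢w , v≢w = separates
              (trans (only (K-clique u≢w u<r w<r) λ
                       { (inj₁ (_ , w≡v)) → v≢w (sym w≡v) ; (inj₂ (_ , w≡u)) → u≢w (sym w≡u) })
                     (only (K-clique (v≢w ∘ sym) w<r v<r) λ
                       { (inj₁ (w≡u , _)) → u≢w (sym w≡u) ; (inj₂ (w≡v , _)) → v≢w (sym w≡v) }))
        where
        open Cut (cutEdge⇒cut {G = H} K-connected cut)
        w<r = ℕₚ.<-≤-trans w<3 (s≤s (s≤s (s≤s z≤n)))
        v<r = s≤s v≤r
        u<r = ℕₚ.<-trans u<v v<r

    pendants : List (Fin (suc r + k) × Fin (suc r + k))
    pendants = tabulate λ i → zero , suc r Fin.↑ʳ i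

    pendants-unique : Unique pendants
    pendants-unique = tabulate⁺ λ eq → Finₚ.↑ʳ-injective (suc r) _ _ (cong proj₂ eq)

    pendants-cutEdges : ∀ u v → (u , v) ∈ pendants ⇔ (u Fin.< v × CutEdge H u v)
    pendants-cutEdges u v = mk⇔ to from
      where
      to : (u , v) ∈ pendants → u Fin.< v × CutEdge H u v
      to p with ∈-tabulate⁻ p
      ... | i , refl = ℕₚ.<-≤-trans (s≤s z≤n) r≤v , K-pendant-cutEdge r≤v
        where r≤v = subst (suc r ≤_) (sym (Finₚ.toℕ-↑ʳ (suc r) i)) (ℕₚ.m≤m+n (suc r) (toℕ i))
      from : u Fin.< v × CutEdge H u v → (u , v) ∈ pendants
      from (u<v , cut) with Fin.splitAt (suc r) v in eq
      ... | inj₁ i = contradiction cut (K-clique-¬cutEdge u<v (subst (_< suc r)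
              (trans (sym (Finₚ.toℕ-↑ˡ i k)) (cong toℕ (Finₚ.splitAt⁻¹-↑ˡ {m = suc r} {i = v} {j = i} eq)))
              (Finₚ.toℕ<n i)))
      ... | inj₂ i with Finₚ.splitAt⁻¹-↑ʳ {m = suc r} {i = v} {j = i} eq
      ...   | refl with K-pendant-neighbour
                (subst (suc r ≤_) (sym (Finₚ.toℕ-↑ʳ (suc r) i)) (ℕₚ.m≤m+n (suc r) (toℕ i))) (proj₁ cut)
      ...     | refl = ∈-tabulate⁺ i

    K∈𝒢 : 𝒢 (suc r + k) k H
    K∈𝒢 = K-connected , pendants , pendants-unique , length-tabulate _ , pendants-cutEdges

    -- Every class contains a clique vertex, as a pendant shares the class of `zero`. An edge
    -- between clique vertices of different classes cannot be a bridge, whatever the numbering of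
    -- the classes.
    K-full : (classes : Classes pendants (suc r)) →
             BridgeStructure.Full H K-connected pendants-unique pendants-cutEdges classes
    K-full classes i j i≢j = edge (onto i) (onto j)
      where
      open BridgeStructure H K-connected pendants-unique pendants-cutEdges classes
      open Classes classes
      representative : ∀ {i} → ∃[ x ] (class x ≡ i) → ∃[ x ] (class x ≡ i × toℕ x < suc r)
      representative (x , x~i) with toℕ x ℕₚ.<? suc r
      ... | yes x<r = x , x~i , x<r
      ... | no  x≮r = zero , trans (adjacent (inj₁ 0x)) x~i , s≤s z≤n
        where
        r≤x = ℕₚ.≮⇒≥ x≮r
        0x = Equivalence.from (pendants-cutEdges zero x) (ℕₚ.<-≤-trans (s≤s z≤n) r≤x , K-pendant-cutEdge r≤x)
      edge : ∃[ x ] (class x ≡ i) → ∃[ y ] (class y ≡ j) → Image class Cyclic i j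
      edge ci cj with representative ci | representative cj
      ... | x , refl , x<r | y , refl , y<r =
            x , y , refl , refl , crossing⇒cyclic (K-clique (i≢j ∘ cong class) x<r y<r) i≢j

  K-¬far : ∀ x y → ¬ Far H x y
  K-¬far x y ((x≢y , ¬xy) , ¬z) = ¬z (zero , symm H (K-universal 0≢x) , K-universal 0≢y)
    where
    0≢x : zero ≢ x
    0≢x refl = ¬xy (K-universal x≢y)
    0≢y : zero ≢ y
    0≢y refl = ¬xy (symm H (K-universal (x≢y ∘ sym)))

-- Comparing a graph with `K n k`

classesOf : ∀ {n k} {G : Graph n} (connected : Connected G) {es : List (Fin n × Fin n)} (unique : Unique es) →
  length es ≡ k → (∀ u v → (u , v) ∈ es ⇔ (u Fin.< v × CutEdge G u v)) →
  ∃[ r ] (r + k ≡ n × Classes es r)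
classesOf {G = G} connected {es} unique refl cutEdges = bridgeClasses {G = G} es unique bridge
  where
  bridge : ∀ {u v} → (u , v) ∈ es → u Fin.< v × Adj G u v × Cut G u v
  bridge {u} {v} p with Equivalence.to (cutEdges u v) p
  ... | u<v , cut = u<v , proj₁ cut , cutEdge⇒cut connected cut

-- The number of classes is n - k for every graph of the family, so `G` and `K n k` can be given the
-- same `r`.
classesOfSize : ∀ {n k r} {G : Graph n} (connected : Connected G) {es : List (Fin n × Fin n)} (unique : Unique es) →
  length es ≡ k → (∀ u v → (u , v) ∈ es ⇔ (u Fin.< v × CutEdge G u v)) →
  r + k ≡ n → Classes es r
classesOfSize {n} {k} {r} {G} connected {es} unique len cutEdges size
  with classesOf {G = G} connected unique len cutEdges
... | r′ , size′ , classes = subst (Classes es) (ℕₚ.+-cancelʳ-≡ k r′ r (trans size′ (sym size))) classes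

theorem2p1 : ∀ {c ℓ₁ ℓ₂ ℓ₃} (ℝ : RealNumbers c ℓ₁ ℓ₂ ℓ₃) →
    let open Spectral ℝ in
    (n k : ℕ) → 1 ≤ n → (∃[ G ] 𝒢 n k G) →
    𝒢 n k (K n k) ×
    ((G : Graph n) → 𝒢 n k G → ¬ (G ≅ K n k) → ¬ (n ≡ 4 × k ≡ 3) → G ≺ₛ K n k)
theorem2p1 ℝ (suc n) k 1≤n (G₀ , connected₀ , es₀ , unique₀ , len₀ , cutEdges₀)
  with classesOf {G = G₀} connected₀ unique₀ len₀ cutEdges₀
... | zero , _ , classes = contradiction (Classes.class classes zero) λ ()
... | suc r , refl , classes₀ = K∈𝒢 r≢1 , last
  where
  open KGraph r k
  open Spectral ℝ using (_≺ₛ_)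
  open Moments ℝ using (closedWalks⇒≺ₛ)

  -- For k = n - 2 the clique would be a single edge, itself a cut edge, and `K n k` would have one
  -- too many. The given graph `G₀` shows that this k does not arise.
  r≢1 : r ≢ 1
  r≢1 = BridgeStructure.classCount≢2 G₀ connected₀ unique₀ cutEdges₀ classes₀ ∘ cong suc

  H : Graph (suc r + k)
  H = K (suc r + k) k

  classesK : Classes (pendants r≢1) (suc r)
  classesK = classesOfSize {G = H} K-connected (pendants-unique r≢1) (length-tabulate _) (pendants-cutEdges r≢1) refl

  module BK = BridgeStructure H K-connected (pendants-unique r≢1) (pendants-cutEdges r≢1) classesK

  last : (G : Graph (suc r + k)) → 𝒢 (suc r + k) k G → ¬ (G ≅ H) → ¬ (suc r + k ≡ 4 × k ≡ 3) → G ≺ₛ H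
  last G (connected , es , unique , len , cutEdges) G≇H n,k≢4,3 = compare full⊎missing
    where
    classes : Classes es (suc r)
    classes = classesOfSize {G = G} connected unique len cutEdges refl
    open BridgeStructure G connected unique cutEdges classes

    lengths : length es + length es ≡ length (pendants r≢1) + length (pendants r≢1)
    lengths = cong (λ k → k + k) (trans len (sym (length-tabulate _)))

    count₂-cyclicK : count₂ BK.cyclic? ≡ count₂ {suc r} (λ i j → ¬? (i Finₚ.≟ j))
    count₂-cyclicK = BK.full⇒count₂-cyclic (K-full r≢1 classesK)

    closedWalks-01 : ∀ {i} → i < 2 → closedWalks G i ≡ closedWalks H i
    closedWalks-01 {0} _ = trans (closedWalks-0 G) (sym (closedWalks-0 H))
    closedWalks-01 {1} _ = trans (closedWalks-1 G) (sym (closedWalks-1 H))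
    closedWalks-01 {suc (suc _)} (s≤s (s≤s ()))

    missing⇒≺ₛ : ∀ {i j} → i ≢ j → ¬ Image (Classes.class classes) Cyclic i j → G ≺ₛ H
    missing⇒≺ₛ i≢j ¬ij = closedWalks⇒≺ₛ 2 (s≤s z≤n) (2≤n i≢j r≢1) (λ _ → closedWalks-01) (begin-strict
      closedWalks G 2                        ≡⟨ trans (closedWalks-2 G) count₂-adj ⟩
      length es + length es + count₂ cyclic? <⟨ ℕₚ.+-monoʳ-< (length es + length es) (missing⇒count₂-cyclic< i≢j ¬ij) ⟩
      length es + length es + count₂ {suc r} (λ i j → ¬? (i Finₚ.≟ j))
                                             ≡⟨ cong₂ _+_ lengths (sym count₂-cyclicK) ⟩
      _                                      ≡⟨ trans (closedWalks-2 H) BK.count₂-adj ⟨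
      closedWalks H 2                        ∎)
      where
      open ℕₚ.≤-Reasoning
      -- Here `r + k` is `n ∸ 1`. Two distinct classes give r ≥ 1, and r = 1 is excluded.
      2≤n : ∀ {r} {i j : Fin (suc r)} → i ≢ j → r ≢ 1 → 2 ≤ r + k
      2≤n {0} {zero} {zero} i≢j _ = contradiction refl i≢j
      2≤n {1}               _ r≢1 = contradiction refl r≢1
      2≤n {suc (suc r)}     _ _   = s≤s (s≤s z≤n)

    module _ (full : Full) where

      count₂-cyclic≡ : count₂ cyclic? ≡ count₂ BK.cyclic?
      count₂-cyclic≡ = trans (full⇒count₂-cyclic full) (sym count₂-cyclicK)

      count₂-adj≡ : count₂ (adj? G) ≡ count₂ (adj? H)
      count₂-adj≡ = trans count₂-adj (trans (cong₂ _+_ lengths count₂-cyclic≡) (sym BK.count₂-adj))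

      count₂-nonadjacent≡ : count₂ (nonadjacent? G) ≡ count₂ (nonadjacent? H)
      count₂-nonadjacent≡ = ℕₚ.+-cancelˡ-≡ (count₂ (adj? G)) _ _
        (trans (sym (count₂-≢ G)) (trans (count₂-≢ H) (cong (_+ count₂ (nonadjacent? H)) (sym count₂-adj≡))))

      closedWalks-0123 : ∀ i → i < 4 → closedWalks G i ≡ closedWalks H i
      closedWalks-0123 0 _ = closedWalks-01 (s≤s z≤n)
      closedWalks-0123 1 _ = closedWalks-01 (s≤s (s≤s z≤n))
      closedWalks-0123 2 _ = trans (closedWalks-2 G) (trans count₂-adj≡ (sym (closedWalks-2 H)))
      closedWalks-0123 3 _ = trans (full⇒closedWalks-3 full)
        (trans (cong (_* (suc r ∸ 2)) count₂-cyclic≡) (sym (BK.full⇒closedWalks-3 (K-full r≢1 classesK))))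
      closedWalks-0123 (suc (suc (suc (suc _)))) (s≤s (s≤s (s≤s (s≤s ()))))

      far⇒≺ₛ : ∀ {x y} → Far G x y → G ≺ₛ H
      far⇒≺ₛ {x} {y} far = closedWalks⇒≺ₛ 4 (s≤s z≤n)
        (ℕₚ.≤-pred (far⇒5≤n full refl n,k≢4,3 far)) closedWalks-0123
        (begin-strict
          closedWalks G 4                        ≡⟨ ℕₚ.+-identityʳ _ ⟨
          closedWalks G 4 + 0                    <⟨ ℕₚ.+-monoʳ-< (closedWalks G 4) (ℕₚ.*-monoˡ-< 2 far>0) ⟩
          closedWalks G 4 + count₂ (far? G) * 2  ≡⟨ full⇒closedWalks-4 full ⟩
          _                                      ≡⟨ cong₂ _+_ count₂-adj≡
                                                      (cong₂ _+_ (cong (_* (q + q * q)) count₂-cyclic≡)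
                                                                 (cong (_* 2) count₂-nonadjacent≡)) ⟩
          _                                      ≡⟨ BK.full⇒closedWalks-4 (K-full r≢1 classesK) ⟨
          closedWalks H 4 + count₂ (far? H) * 2  ≡⟨ cong (λ m → closedWalks H 4 + m * 2)
                                                      (count₂-none (far? H) K-¬far) ⟩
          closedWalks H 4 + 0                    ≡⟨ ℕₚ.+-identityʳ _ ⟩
          closedWalks H 4                        ∎)
        where
        open ℕₚ.≤-Reasoning
        q = suc r ∸ 2
        -- The empty relation, of which `Far` is a strict extension; its count is the lower bound
        -- from which positivity follows.
        none? : ∀ (x y : Fin (suc r + k)) → Dec ⊥
        none? _ _ = no λ ()
        far>0 : 0 < count₂ (far? G)
        far>0 = ℕₚ.≤-<-trans z≤n (count₂-mono-< none? (far? G) (λ _ _ ()) (λ ()) far)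

      near⇒≅ : (∀ x y → ¬ Far G x y) → G ≅ H
      near⇒≅ near with universal-vertex near full zero
      ... | h , universal = universal⇒≅K full universal k (ℕₚ.m+n∸n≡m (suc r) k)

    compare : Full ⊎ ∃[ i ] ∃[ j ] (i ≢ j × ¬ Image (Classes.class classes) Cyclic i j) → G ≺ₛ H
    compare (inj₂ (i , j , i≢j , ¬ij)) = missing⇒≺ₛ i≢j ¬ij
    compare (inj₁ full) with Finₚ.any? (λ x → Finₚ.any? (far? G x))
    ... | yes (x , y , far) = far⇒≺ₛ full far
    ... | no ¬far           = contradiction (near⇒≅ full λ x y far → ¬far (x , y , far)) G≇H
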